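{- For $1\le N\le 2^n$ let $E_\lambda(n,N)=\max\{E_\lambda(Z): Z\subset\{0,1\}^n,\ |Z|=N\}$. Then for every $N\ge1$, $E_\lambda(n,N)\le(N-1)\lambda(n)$. If $n=2t-1$, then $$E_\lambda(n,N)\le\begin{cases}\lambda(t)\big(N-\tfrac12\big), & t\text{ even},\\[2pt] \frac{\lambda(t)}{n+1}\big(Nn-\tfrac{n-1}2\big), & t\text{ odd}.\end{cases}$$ If $n$ is odd, then $$E_\lambda(n,N)\le N\hat\lambda_0+(2^n-N)\hat\lambda_{\frac{n+1}2}=N\Lambda_n-\Big(1-\frac N{2^n}\Big)\binom{n-1}{\frac{n-1}2}.$$
   Context: $d$ is the Hamming distance on $\{0,1\}^n$; $\lambda(w)=2^{n-w}w\binom{w-1}{\lceil w/2\rceil-1}$ for $1\le w\le n$ and $\lambda(0)=0$ (this is the value of $\frac12\sum_u|d(x,u)-d(y,u)|$ when $d(x,y)=w$). For $Z=\{z_1,\dots,z_N\}$, $E_\lambda(Z)=\frac1N\sum_{i,j=1}^N\lambda(d(z_i,z_j))$. $\Lambda_n=\hat\lambda_0=\frac n{2^{n+1}}\binom{2n}n$, and $\hat\lambda_k=-2^{ -n}\sum_{s=0}^{n-1}(K_s^{(n-1)}(k-1))^2$ for $k\ge1$, with Krawtchouk polynomials $K_k^{(m)}(x)=\sum_{i=0}^k(-1)^i\binom xi\binom{m-x}{k-i}$. -}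

module Defs where

open import Data.Bool using (Bool; true; false)
open import Data.Nat as ℕ using (ℕ; zero; suc; _∸_; _^_; ⌈_/2⌉)
open import Data.Nat.Combinatorics using (_C_)
open import Data.Integer as ℤ using (ℤ; +_)
open import Data.Rational as ℚ using (ℚ; _/_; 0ℚ; 1ℚ; ½)
open import Data.List using (List; []; _∷_; map; length; upTo)
open import Data.Nat.ListAction using (sum)
open import Data.Vec using (Vec; []; _∷_)

Point : ℕ → Set
Point n = Vec Bool n

hamming : ∀ {n} → Point n → Point n → ℕ
hamming [] [] = 0
hamming (true ∷ x) (true ∷ y) = hamming x y
hamming (false ∷ x) (false ∷ y) = hamming x y
hamming (true ∷ x) (false ∷ y) = suc (hamming x y)
hamming (false ∷ x) (true ∷ y) = suc (hamming x y)

lam : ℕ → ℕ → ℕ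
lam n zero = 0
lam n (suc v) = 2 ^ (n ∸ suc v) ℕ.* suc v ℕ.* (v C (⌈ suc v /2⌉ ∸ 1))

ι : ℕ → ℚ
ι k = + k / 1

recipSuc : ℕ → ℚ
recipSuc k = + 1 / suc k

inv2^ : ℕ → ℚ
inv2^ zero = 1ℚ
inv2^ (suc k) = ½ ℚ.* inv2^ k

pairSum : ∀ n → List (Point n) → ℕ
pairSum n Z = sum (map (λ x → sum (map (λ y → lam n (hamming x y)) Z)) Z)

Eλ : ∀ n → List (Point n) → ℚ
Eλ n [] = 0ℚ
Eλ n Z@(_ ∷ zs) = + pairSum n Z / length Z

sgn : ℕ → ℤ
sgn zero = ℤ.+ 1
sgn (suc i) = ℤ.- sgn i

-- Krawtchouk polynomial K_k^{(m)}(x) = Σ_{i=0}^k (-1)^i C(x,i) C(m-x,k-i)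
-- (used only for 0 ≤ x ≤ m, where m - x is the ordinary difference)
kraw : (m k x : ℕ) → ℤ
kraw m k x = Data.List.foldr ℤ._+_ (ℤ.+ 0)
  (map (λ i → sgn i ℤ.* (+ ((x C i) ℕ.* ((m ∸ x) C (k ∸ i))))) (upTo (suc k)))

Λ : ℕ → ℚ
Λ n = ι (n ℕ.* ((2 ℕ.* n) C n)) ℚ.* inv2^ (suc n)

lamHat : ℕ → ℕ → ℚ
lamHat n zero = Λ n
lamHat n (suc j) = ℚ.- (inv2^ n ℚ.* ((Data.List.foldr ℤ._+_ (ℤ.+ 0)
  (map (λ s → kraw (n ∸ 1) s j ℤ.* kraw (n ∸ 1) s j) (upTo n))) / 1))

{-# OPTIONS --safe #-}

-- All bounds come from linear programming on the Hamming cube, done without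
-- characters.  Splitting off one coordinate turns a quadratic form with kernel
-- f(d(x,y)) into half the sum of two forms in one dimension less, with kernels
-- f + Sf and f − Sf, where S is the shift (Sf)(w) = f(w+1).  Hence the
-- eigenvalues of the kernel are ((1+S)^p (1−S)^q f)(0) with p + q = n, and a
-- kernel whose eigenvalues with q ≥ 1 are ≤ 0 has pair sum at most N² times its
-- average.
--
-- The bounds at n = 2t−1: λ is constant on {2i−1, 2i} and concave in i = ⌈w/2⌉,
-- so it lies below a chord, an affine function of ⌈w/2⌉ whose nontrivial
-- eigenvalues are ≤ 0; at distance 0 the chord exceeds λ, which gives the term
-- linear in N.
--
-- The bound at n = 2m+1: λ(w) = 2^(n−w) e(w) and e(w+1) − 2e(w) = c(w), where
-- c(w) is the mean of (2 cos θ)^w.  So the nontrivial eigenvalues of λ are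
-- −H(p,q), where H(p,q) is the mean of (2 + 2cos θ)^p (2 − 2cos θ)^q and
-- p + q = 2m.  Integration by parts, in algebraic form, gives
-- (2q+1) H(p+1,q) = (2p+1) H(p,q+1), so H is smallest at p = q = m, where it is
-- C(2m,m); hence adding C(2m,m) to λ at distance 0 keeps these eigenvalues ≤ 0.
module Submission where

open import Defs
open import Data.Bool using (Bool; true; false)
open import Data.Nat as ℕ using (ℕ; zero; suc; _∸_; _^_; _%_; z≤n; s≤s; ⌊_/2⌋; ⌈_/2⌉)
import Data.Nat.DivMod as ℕ
import Data.Nat.Properties as ℕ
open import Data.Nat.Combinatorics using (_C_; nCk≡nC[n∸k]; k>n⇒nCk≡0; nCk+nC[k+1]≡[n+1]C[k+1])
open import Data.Nat.ListAction using (sum)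
open import Data.Nat.Tactic.RingSolver using () renaming (solve-∀ to solve-∀ℕ)
open import Data.Integer as ℤ using (ℤ; +_; _+_; _*_; -_; _≤_; 0ℤ; 1ℤ; +≤+)
import Data.Integer.Properties as ℤ
open import Data.Integer.Tactic.RingSolver using (solve-∀)
open import Data.Rational as ℚ using (ℚ; ½; 1ℚ; toℚᵘ)
import Data.Rational.Properties as ℚ
open import Data.Rational.Solver using (module +-*-Solver)
open import Data.Rational.Unnormalised as ℚᵘ using (mkℚᵘ; _≃_; *≡*; *≤*)
import Data.Rational.Unnormalised.Properties as ℚᵘ
open import Data.List using (List; []; _∷_; length; map; foldr; applyUpTo; upTo)
open import Data.List.Relation.Unary.All as All using (All; []; _∷_)
open import Data.List.Relation.Unary.AllPairs using ([]; _∷_)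
open import Data.List.Relation.Unary.Unique.Propositional using (Unique)
open import Data.Product using (∃; _,_; _×_)
open import Data.Sum using (_⊎_; inj₁; inj₂)
open import Data.Vec as Vec using ([]; _∷_)
open import Function using (id)
open import Relation.Nullary using (contradiction)
open import Relation.Binary.PropositionalEquality using (_≡_; _≢_; refl; sym; trans; cong; cong₂; subst; subst₂; module ≡-Reasoning)
open +-*-Solver using (solve; _:+_; _:*_; _:-_; :-_; _:=_; con)

private variable
  A : Set


-- Integer sums over lists

∑ : List A → (A → ℤ) → ℤ
∑ []      f = 0ℤ
∑ (a ∷ L) f = f a + ∑ L f

∑-cong : ∀ (L : List A) {f g} → (∀ a → f a ≡ g a) → ∑ L f ≡ ∑ L g
∑-cong []      h = refl
∑-cong (a ∷ L) h = cong₂ _+_ (h a) (∑-cong L h)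

∑-mono : ∀ (L : List A) {f g} → (∀ a → f a ≤ g a) → ∑ L f ≤ ∑ L g
∑-mono []      h = ℤ.≤-refl
∑-mono (a ∷ L) h = ℤ.+-mono-≤ (h a) (∑-mono L h)

∑-+ : ∀ (L : List A) f g → ∑ L (λ a → f a + g a) ≡ ∑ L f + ∑ L g
∑-+ []      f g = refl
∑-+ (a ∷ L) f g = trans (cong (_+_ (f a + g a)) (∑-+ L f g)) (ring (f a) (g a) _ _)
  where
  ring : ∀ u v x y → (u + v) + (x + y) ≡ (u + x) + (v + y)
  ring = solve-∀

∑-*ˡ : ∀ (L : List A) k f → ∑ L (λ a → k * f a) ≡ k * ∑ L f
∑-*ˡ []      k f = sym (ℤ.*-zeroʳ k)
∑-*ˡ (a ∷ L) k f = trans (cong (_+_ (k * f a)) (∑-*ˡ L k f)) (sym (ℤ.*-distribˡ-+ k (f a) (∑ L f)))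

∑-1 : ∀ (L : List A) → ∑ L (λ _ → 1ℤ) ≡ + length L
∑-1 []      = refl
∑-1 (a ∷ L) = cong (_+_ 1ℤ) (∑-1 L)

-- Shift operators

-- T r p q = (r + S)^p (r − S)^q for the shift S.
T : ℤ → ℕ → ℕ → (ℕ → ℤ) → ℕ → ℤ
T r zero    zero    f w = f w
T r zero    (suc q) f w = r * T r zero q f w + - T r zero q f (suc w)
T r (suc p) q       f w = r * T r p q f w + T r p q f (suc w)

-- `T` unfolds its factors `r + S` first, so a factor `r - S` is directly visible only for `p = 0`;
-- for larger `p` it is extracted because the two kinds of factor commute.
T-minus : ∀ r p q f w → T r p (suc q) f w ≡ r * T r p q f w + - T r p q f (suc w)
T-minus r zero    q f w = refl
T-minus r (suc p) q f w
  rewrite T-minus r p q f w | T-minus r p q f (suc w) = ring r _ _ _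
  where
  ring : ∀ r a b c → r * (r * a + - b) + (r * b + - c) ≡ r * (r * a + b) + - (r * b + c)
  ring = solve-∀

T-lin : ∀ r p q k l f g w →
  T r p q (λ v → k * f v + l * g v) w ≡ k * T r p q f w + l * T r p q g w
T-lin r zero    zero    k l f g w = refl
T-lin r zero    (suc q) k l f g w
  rewrite T-lin r zero q k l f g w | T-lin r zero q k l f g (suc w) = ring r k l _ _ _ _
  where
  ring : ∀ r k l a b c d → r * (k * a + l * b) + - (k * c + l * d) ≡ k * (r * a + - c) + l * (r * b + - d)
  ring = solve-∀
T-lin r (suc p) q       k l f g w
  rewrite T-lin r p q k l f g w | T-lin r p q k l f g (suc w) = ring r k l _ _ _ _
  where
  ring : ∀ r k l a b c d → r * (k * a + l * b) + (k * c + l * d) ≡ k * (r * a + c) + l * (r * b + d)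
  ring = solve-∀

T-shift : ∀ r p q f w → T r p q (λ v → f (suc v)) w ≡ T r p q f (suc w)
T-shift r zero    zero    f w = refl
T-shift r zero    (suc q) f w rewrite T-shift r zero q f w | T-shift r zero q f (suc w) = refl
T-shift r (suc p) q       f w rewrite T-shift r p q f w | T-shift r p q f (suc w) = refl

plus minus : ℤ → (ℕ → ℤ) → ℕ → ℤ
plus  r f w = r * f w + 1ℤ * f (suc w)
minus r f w = r * f w + - 1ℤ * f (suc w)

-- Splitting off a coordinate applies a factor to `f` before all others, whereas `T` has it
-- outermost. Linearity and commutation with the shift make the order immaterial.
T-plus-inner : ∀ r p q f w → T r p q (plus r f) w ≡ T r (suc p) q f w
T-plus-inner r p q f w = begin-equality
  T r p q (plus r f) w                                    ≡⟨ T-lin r p q r 1ℤ f (λ v → f (suc v)) w ⟩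
  r * T r p q f w + 1ℤ * T r p q (λ v → f (suc v)) w      ≡⟨ cong (_+_ (r * T r p q f w)) (trans (ℤ.*-identityˡ _) (T-shift r p q f w)) ⟩
  r * T r p q f w + T r p q f (suc w)                     ∎
  where open ℤ.≤-Reasoning

T-minus-inner : ∀ r p q f w → T r p q (minus r f) w ≡ T r p (suc q) f w
T-minus-inner r p q f w = begin-equality
  T r p q (minus r f) w                                   ≡⟨ T-lin r p q r (- 1ℤ) f (λ v → f (suc v)) w ⟩
  r * T r p q f w + - 1ℤ * T r p q (λ v → f (suc v)) w    ≡⟨ cong (_+_ (r * T r p q f w)) (trans (ℤ.-1*i≡-i _) (cong -_ (T-shift r p q f w))) ⟩
  r * T r p q f w + - T r p q f (suc w)                   ≡⟨ T-minus r p q f w ⟨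
  T r p (suc q) f w                                       ∎
  where open ℤ.≤-Reasoning

-- Kernels

hamming≤n : ∀ {n} (x y : Point n) → hamming x y ℕ.≤ n
hamming≤n []          []          = z≤n
hamming≤n (true ∷ x)  (true ∷ y)  = ℕ.m≤n⇒m≤1+n (hamming≤n x y)
hamming≤n (true ∷ x)  (false ∷ y) = s≤s (hamming≤n x y)
hamming≤n (false ∷ x) (true ∷ y)  = s≤s (hamming≤n x y)
hamming≤n (false ∷ x) (false ∷ y) = ℕ.m≤n⇒m≤1+n (hamming≤n x y)

-- The scaling by powers of r keeps λ integral: λ has r = 2, unscaled kernels r = 1.
kernel : ℤ → ∀ n → (ℕ → ℤ) → Point n → Point n → ℤ
kernel r n f x y = r ℤ.^ (n ∸ hamming x y) * f (hamming x y)

-- Signs of the first coordinate; weights absorb them when a coordinate is split off.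
bit : Bool → ℤ
bit true  = 1ℤ
bit false = - 1ℤ

-- Equal first bits leave the distance alone and raise the exponent of `r` by one; different bits
-- raise the distance and leave the exponent alone. Up to a common power the kernel is thus `r f` or
-- `S f`, half the sum or half the difference of `r f + S f` and `r f - S f`.
kernel-split : ∀ r n f (x y : Point (suc n)) →
  + 2 * kernel r (suc n) f x y ≡
    kernel r n (plus r f) (Vec.tail x) (Vec.tail y) +
    bit (Vec.head x) * bit (Vec.head y) * kernel r n (minus r f) (Vec.tail x) (Vec.tail y)
kernel-split r n f (a ∷ x) (b ∷ y) = go a b
  where
  d = hamming x y
  e = r ℤ.^ (n ∸ d)
  same : ∀ r e u v → + 2 * (r * e * u) ≡ e * (r * u + 1ℤ * v) + 1ℤ * (e * (r * u + - 1ℤ * v))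
  same = solve-∀
  diff : ∀ r e u v → + 2 * (e * v) ≡ e * (r * u + 1ℤ * v) + - 1ℤ * (e * (r * u + - 1ℤ * v))
  diff = solve-∀
  pow : r ℤ.^ (suc n ∸ d) ≡ r * e
  pow = cong (r ℤ.^_) (ℕ.+-∸-assoc 1 (hamming≤n x y))
  go : ∀ a b → + 2 * kernel r (suc n) f (a ∷ x) (b ∷ y) ≡
    kernel r n (plus r f) x y + bit a * bit b * kernel r n (minus r f) x y
  go true  true  rewrite pow = same r e (f d) (f (suc d))
  go true  false = diff r e (f d) (f (suc d))
  go false true  = diff r e (f d) (f (suc d))
  go false false rewrite pow = same r e (f d) (f (suc d))

-- Points are indexed by `A` because deleting a coordinate can merge points, while each index keeps
-- its own weight.
form : ℤ → ∀ n → (ℕ → ℤ) → List A → (A → ℤ) → (A → Point n) → ℤ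
form r n f L α x = ∑ L λ a → ∑ L λ b → α a * α b * kernel r n f (x a) (x b)

form-zero : ∀ r f (L : List A) α (x : A → Point 0) → form r 0 f L α x ≡ f 0 * (∑ L α * ∑ L α)
form-zero r f L α x = begin-equality
  form r 0 f L α x                  ≡⟨ ∑-cong L (λ a → trans (∑-cong L (λ b → inner a b (x a) (x b))) (∑-*ˡ L (f 0 * α a) α)) ⟩
  ∑ L (λ a → f 0 * α a * ∑ L α)     ≡⟨ ∑-cong L (λ a → ring (f 0) (α a) (∑ L α)) ⟩
  ∑ L (λ a → f 0 * ∑ L α * α a)     ≡⟨ ∑-*ˡ L (f 0 * ∑ L α) α ⟩
  f 0 * ∑ L α * ∑ L α               ≡⟨ ℤ.*-assoc (f 0) _ _ ⟩
  f 0 * (∑ L α * ∑ L α)             ∎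
  where
  open ℤ.≤-Reasoning
  ring : ∀ f a s → f * a * s ≡ f * s * a
  ring = solve-∀
  ring′ : ∀ a b f → a * b * (1ℤ * f) ≡ f * a * b
  ring′ = solve-∀
  inner : ∀ a b u v → α a * α b * kernel r 0 f u v ≡ f 0 * α a * α b
  inner a b [] [] = ring′ (α a) (α b) (f 0)

-- The sign in `kernel-split` is a factor depending on `a` times one depending on `b`, so the
-- weights absorb it and the second summand is again a `form`.
form-suc : ∀ r n f (L : List A) α (x : A → Point (suc n)) →
  + 2 * form r (suc n) f L α x ≡
    form r n (plus r f) L α (λ a → Vec.tail (x a)) +
    form r n (minus r f) L (λ a → bit (Vec.head (x a)) * α a) (λ a → Vec.tail (x a))
form-suc r n f L α x = begin-equality
  + 2 * form r (suc n) f L α x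
    ≡⟨ ∑-*ˡ L (+ 2) _ ⟨
  ∑ L (λ a → + 2 * ∑ L (λ b → α a * α b * kernel r (suc n) f (x a) (x b)))
    ≡⟨ ∑-cong L (λ a → begin-equality
         + 2 * ∑ L (λ b → α a * α b * kernel r (suc n) f (x a) (x b))      ≡⟨ ∑-*ˡ L (+ 2) _ ⟨
         ∑ L (λ b → + 2 * (α a * α b * kernel r (suc n) f (x a) (x b)))    ≡⟨ ∑-cong L (λ b → term a b) ⟩
         ∑ L (λ b → P a b + M a b)                               ≡⟨ ∑-+ L (P a) (M a) ⟩
         ∑ L (P a) + ∑ L (M a)                                   ∎) ⟩
  ∑ L (λ a → ∑ L (P a) + ∑ L (M a))
    ≡⟨ ∑-+ L (λ a → ∑ L (P a)) (λ a → ∑ L (M a)) ⟩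
  ∑ L (λ a → ∑ L (P a)) + ∑ L (λ a → ∑ L (M a)) ∎
  where
  open ℤ.≤-Reasoning
  P M : _ → _ → ℤ
  P a b = α a * α b * kernel r n (plus r f) (Vec.tail (x a)) (Vec.tail (x b))
  M a b = bit (Vec.head (x a)) * α a * (bit (Vec.head (x b)) * α b) * kernel r n (minus r f) (Vec.tail (x a)) (Vec.tail (x b))
  ring₁ : ∀ a b k → + 2 * (a * b * k) ≡ a * b * (+ 2 * k)
  ring₁ = solve-∀
  ring₂ : ∀ a b u v p m → a * b * (p + u * v * m) ≡ a * b * p + u * a * (v * b) * m
  ring₂ = solve-∀
  term : ∀ a b → + 2 * (α a * α b * kernel r (suc n) f (x a) (x b)) ≡ P a b + M a b
  term a b = trans (ring₁ (α a) (α b) _)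
    (trans (cong (α a * α b *_) (kernel-split r n f (x a) (x b)))
           (ring₂ (α a) (α b) (bit (Vec.head (x a))) (bit (Vec.head (x b))) _ _))

0≤i*i : ∀ i → 0ℤ ≤ i * i
0≤i*i (+ zero)     = ℤ.≤-refl
0≤i*i (+ suc n)    = +≤+ z≤n
0≤i*i ℤ.-[1+ n ]   = +≤+ z≤n

i≤0∧0≤j⇒i*j≤0 : ∀ {i j} → i ≤ 0ℤ → 0ℤ ≤ j → i * j ≤ 0ℤ
i≤0∧0≤j⇒i*j≤0 {j = j} h k = ℤ.*-monoʳ-≤-nonNeg j ⦃ ℤ.nonNegative k ⦄ h

-- Both halves of `form-suc` inherit the hypothesis, one with a factor `r + S` already spent, the
-- other with `r - S`; in dimension 0 only `f 0` times a square remains.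
form-nonPos : ∀ r n f (L : List A) α x → (∀ p q → p ℕ.+ q ≡ n → T r p q f 0 ≤ 0ℤ) →
  form r n f L α x ≤ 0ℤ
form-nonPos r zero    f L α x h =
  subst (_≤ 0ℤ) (sym (form-zero r f L α x)) (i≤0∧0≤j⇒i*j≤0 (h 0 0 refl) (0≤i*i (∑ L α)))
form-nonPos r (suc n) f L α x h = ℤ.*-cancelˡ-≤-pos _ 0ℤ (+ 2)
  (subst (_≤ 0ℤ) (sym (form-suc r n f L α x)) (ℤ.+-mono-≤
    (form-nonPos r n (plus r f) L α (λ a → Vec.tail (x a)) λ p q e →
      subst (_≤ 0ℤ) (sym (T-plus-inner r p q f 0)) (h (suc p) q (cong suc e)))
    (form-nonPos r n (minus r f) L (λ a → bit (Vec.head (x a)) * α a) (λ a → Vec.tail (x a)) λ p q e →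
      subst (_≤ 0ℤ) (sym (T-minus-inner r p q f 0)) (h p (suc q) (trans (ℕ.+-suc p q) (cong suc e))))))

-- Only the branch taking `plus` at every coordinate meets the eigenvalue with `q = 0`, and it keeps
-- the weights `α`, hence the squared total weight. Every other branch contains a `minus` and is
-- discarded by `form-nonPos`. The power of 2 collects the halvings.
form-bound : ∀ r n f (L : List A) α x → (∀ p q → p ℕ.+ q ℕ.+ 1 ≡ n → T r p (suc q) f 0 ≤ 0ℤ) →
  (+ 2) ℤ.^ n * form r n f L α x ≤ T r n 0 f 0 * (∑ L α * ∑ L α)
form-bound r zero    f L α x h = ℤ.≤-reflexive (trans (ℤ.*-identityˡ _) (form-zero r f L α x))
form-bound r (suc n) f L α x h = begin
  + 2 * (+ 2) ℤ.^ n * form r (suc n) f L α x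
    ≡⟨ trans (ring₁ ((+ 2) ℤ.^ n) _) (cong ((+ 2) ℤ.^ n *_) (form-suc r n f L α x)) ⟩
  (+ 2) ℤ.^ n * (F + G)
    ≤⟨ ℤ.*-monoˡ-≤-nonNeg ((+ 2) ℤ.^ n) ⦃ nn n ⦄ (ℤ.+-monoʳ-≤ F G≤0) ⟩
  (+ 2) ℤ.^ n * (F + 0ℤ)
    ≡⟨ cong ((+ 2) ℤ.^ n *_) (ℤ.+-identityʳ F) ⟩
  (+ 2) ℤ.^ n * F
    ≤⟨ form-bound r n (plus r f) L α (λ a → Vec.tail (x a)) (λ p q e →
      subst (_≤ 0ℤ) (sym (T-plus-inner r p (suc q) f 0)) (h (suc p) q (cong suc e))) ⟩
  T r n 0 (plus r f) 0 * (∑ L α * ∑ L α)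
    ≡⟨ cong (_* (∑ L α * ∑ L α)) (T-plus-inner r n 0 f 0) ⟩
  T r (suc n) 0 f 0 * (∑ L α * ∑ L α) ∎
  where
  open ℤ.≤-Reasoning
  F = form r n (plus r f) L α (λ a → Vec.tail (x a))
  G = form r n (minus r f) L (λ a → bit (Vec.head (x a)) * α a) (λ a → Vec.tail (x a))
  G≤0 : G ≤ 0ℤ
  G≤0 = form-nonPos r n (minus r f) L (λ a → bit (Vec.head (x a)) * α a) (λ a → Vec.tail (x a)) λ p q e →
    subst (_≤ 0ℤ) (sym (T-minus-inner r p q f 0)) (h p q (trans (ℕ.+-comm (p ℕ.+ q) 1) (cong suc e)))
  ring₁ : ∀ p k → + 2 * p * k ≡ p * (+ 2 * k)
  ring₁ = solve-∀
  nn : ∀ n → ℤ.NonNegative ((+ 2) ℤ.^ n)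
  nn zero = _
  nn (suc n) with (+ 2) ℤ.^ n | nn n
  ... | + k | _ = ℤ.nonNegative (subst (0ℤ ≤_) (ℤ.pos-* 2 k) (+≤+ z≤n))

-- Central binomial coefficients

absorption : ∀ n k → suc k ℕ.* (suc n C suc k) ≡ suc n ℕ.* (n C k)
absorption zero    zero    = refl
absorption zero    (suc k) = trans
  (cong (suc (suc k) ℕ.*_) (k>n⇒nCk≡0 {1} {suc (suc k)} (s≤s (s≤s z≤n))))
  (trans (ℕ.*-zeroʳ (suc (suc k))) (sym (cong (1 ℕ.*_) (k>n⇒nCk≡0 {0} {suc k} (s≤s z≤n)))))
absorption (suc n) zero    = begin-equality
  1 ℕ.* (suc (suc n) C 1)                   ≡⟨ cong (1 ℕ.*_) (nCk+nC[k+1]≡[n+1]C[k+1] (suc n) 0) ⟨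
  1 ℕ.* (1 ℕ.+ (suc n C 1))                 ≡⟨ ring (suc n C 1) ⟩
  1 ℕ.+ 1 ℕ.* (suc n C 1)                   ≡⟨ cong suc (absorption n 0) ⟩
  1 ℕ.+ suc n ℕ.* 1                         ≡⟨⟩
  suc (suc n) ℕ.* 1                         ∎
  where
  open ℕ.≤-Reasoning
  ring : ∀ a → 1 ℕ.* (1 ℕ.+ a) ≡ 1 ℕ.+ 1 ℕ.* a
  ring = solve-∀ℕ
absorption (suc n) (suc k) = begin-equality
  suc (suc k) ℕ.* (suc (suc n) C suc (suc k))
    ≡⟨ cong (suc (suc k) ℕ.*_) (nCk+nC[k+1]≡[n+1]C[k+1] (suc n) (suc k)) ⟨
  suc (suc k) ℕ.* ((suc n C suc k) ℕ.+ (suc n C suc (suc k)))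
    ≡⟨ ring₁ k (suc n C suc k) _ ⟩
  (suc n C suc k) ℕ.+ (suc k ℕ.* (suc n C suc k) ℕ.+ suc (suc k) ℕ.* (suc n C suc (suc k)))
    ≡⟨ cong ((suc n C suc k) ℕ.+_) (cong₂ ℕ._+_ (absorption n k) (absorption n (suc k))) ⟩
  (suc n C suc k) ℕ.+ (suc n ℕ.* (n C k) ℕ.+ suc n ℕ.* (n C suc k))
    ≡⟨ cong ((suc n C suc k) ℕ.+_) (ℕ.*-distribˡ-+ (suc n) (n C k) (n C suc k)) ⟨
  (suc n C suc k) ℕ.+ suc n ℕ.* ((n C k) ℕ.+ (n C suc k))
    ≡⟨ cong (λ z → (suc n C suc k) ℕ.+ suc n ℕ.* z) (nCk+nC[k+1]≡[n+1]C[k+1] n k) ⟩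
  suc (suc n) ℕ.* (suc n C suc k) ∎
  where
  open ℕ.≤-Reasoning
  ring₁ : ∀ k a b → suc (suc k) ℕ.* (a ℕ.+ b) ≡ a ℕ.+ (suc k ℕ.* a ℕ.+ suc (suc k) ℕ.* b)
  ring₁ = solve-∀ℕ

central : ℕ → ℕ
central i = (2 ℕ.* i) C i

middle : ∀ i → suc i ℕ.* (suc (2 ℕ.* i) C i) ≡ suc (2 ℕ.* i) ℕ.* central i
middle i = begin-equality
  suc i ℕ.* (suc (2 ℕ.* i) C i)        ≡⟨ cong (suc i ℕ.*_) (nCk≡nC[n∸k] (ℕ.m≤n⇒m≤1+n (ℕ.m≤m+n i (i ℕ.+ 0)))) ⟩
  suc i ℕ.* (suc (2 ℕ.* i) C (suc (2 ℕ.* i) ∸ i))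
                                       ≡⟨ cong (λ k → suc i ℕ.* (suc (2 ℕ.* i) C k)) compl ⟩
  suc i ℕ.* (suc (2 ℕ.* i) C suc i)    ≡⟨ absorption (2 ℕ.* i) i ⟩
  suc (2 ℕ.* i) ℕ.* central i          ∎
  where
  open ℕ.≤-Reasoning
  ring : ∀ i → suc (2 ℕ.* i) ≡ i ℕ.+ suc i
  ring = solve-∀ℕ
  compl : suc (2 ℕ.* i) ∸ i ≡ suc i
  compl = trans (cong (_∸ i) (ring i)) (ℕ.m+n∸m≡n i (suc i))

central-suc : ∀ i → suc i ℕ.* central (suc i) ≡ 2 ℕ.* suc (2 ℕ.* i) ℕ.* central i
central-suc i = begin-equality
  suc i ℕ.* ((2 ℕ.* suc i) C suc i)              ≡⟨ cong (λ k → suc i ℕ.* (k C suc i)) (ℕ.*-suc 2 i) ⟩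
  suc i ℕ.* (suc (suc (2 ℕ.* i)) C suc i)        ≡⟨ absorption (suc (2 ℕ.* i)) i ⟩
  suc (suc (2 ℕ.* i)) ℕ.* (suc (2 ℕ.* i) C i)    ≡⟨ ring i (suc (2 ℕ.* i) C i) ⟩
  2 ℕ.* (suc i ℕ.* (suc (2 ℕ.* i) C i))          ≡⟨ cong (2 ℕ.*_) (middle i) ⟩
  2 ℕ.* (suc (2 ℕ.* i) ℕ.* central i)            ≡⟨ ℕ.*-assoc 2 (suc (2 ℕ.* i)) (central i) ⟨
  2 ℕ.* suc (2 ℕ.* i) ℕ.* central i              ∎
  where
  open ℕ.≤-Reasoning
  ring : ∀ i k → suc (suc (2 ℕ.* i)) ℕ.* k ≡ 2 ℕ.* (suc i ℕ.* k)
  ring = solve-∀ℕ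

⌊2i/2⌋ : ∀ i → ⌊ 2 ℕ.* i /2⌋ ≡ i
⌊2i/2⌋ i = trans (cong (λ k → ⌊ i ℕ.+ k /2⌋) (ℕ.+-identityʳ i)) (sym (ℕ.n≡⌊n+n/2⌋ i))

⌊1+2i/2⌋ : ∀ i → ⌊ suc (2 ℕ.* i) /2⌋ ≡ i
⌊1+2i/2⌋ i = trans (cong (λ k → ⌈ i ℕ.+ k /2⌉) (ℕ.+-identityʳ i)) (sym (ℕ.n≡⌈n+n/2⌉ i))

parity : ∀ w → ∃ λ i → w ≡ 2 ℕ.* i ⊎ w ≡ suc (2 ℕ.* i)
parity zero    = 0 , inj₁ refl
parity (suc w) with parity w
... | i , inj₁ refl = i , inj₂ refl
... | i , inj₂ refl = suc i , inj₁ (sym (ℕ.*-suc 2 i))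

-- λ(w) = 2^(n-w) core(w).
core : ℕ → ℕ
core zero    = 0
core (suc v) = suc v ℕ.* (v C (⌈ suc v /2⌉ ∸ 1))

lam≡core : ∀ n w → lam n w ≡ 2 ℕ.^ (n ∸ w) ℕ.* core w
lam≡core n zero    = sym (ℕ.*-zeroʳ (2 ℕ.^ n))
lam≡core n (suc v) = ℕ.*-assoc (2 ℕ.^ (n ∸ suc v)) (suc v) _

core-odd : ∀ i → core (suc (2 ℕ.* i)) ≡ suc (2 ℕ.* i) ℕ.* central i
core-odd i = cong (λ k → suc (2 ℕ.* i) ℕ.* ((2 ℕ.* i) C k)) (⌊2i/2⌋ i)

core-even : ∀ i → core (2 ℕ.* i) ≡ i ℕ.* central i
core-even zero    = refl
core-even (suc i) = begin-equality
  core (2 ℕ.* suc i)                                       ≡⟨ cong core (ℕ.*-suc 2 i) ⟩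
  suc (suc (2 ℕ.* i)) ℕ.* (suc (2 ℕ.* i) C ⌊ suc (2 ℕ.* i) /2⌋)
                                                           ≡⟨ cong (λ k → suc (suc (2 ℕ.* i)) ℕ.* (suc (2 ℕ.* i) C k)) (⌊1+2i/2⌋ i) ⟩
  suc (suc (2 ℕ.* i)) ℕ.* (suc (2 ℕ.* i) C i)              ≡⟨ absorption (suc (2 ℕ.* i)) i ⟨
  suc i ℕ.* (suc (suc (2 ℕ.* i)) C suc i)                  ≡⟨ cong (λ k → suc i ℕ.* (k C suc i)) (ℕ.*-suc 2 i) ⟨
  suc i ℕ.* central (suc i)                                ∎
  where open ℕ.≤-Reasoning

core-even-step : ∀ i → core (suc (2 ℕ.* i)) ≡ 2 ℕ.* core (2 ℕ.* i) ℕ.+ central i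
core-even-step i = trans (core-odd i)
  (trans (ring i (central i)) (cong (λ k → 2 ℕ.* k ℕ.+ central i) (sym (core-even i))))
  where
  ring : ∀ i k → suc (2 ℕ.* i) ℕ.* k ≡ 2 ℕ.* (i ℕ.* k) ℕ.+ k
  ring = solve-∀ℕ

core-odd-step : ∀ i → core (suc (suc (2 ℕ.* i))) ≡ 2 ℕ.* core (suc (2 ℕ.* i))
core-odd-step i = begin-equality
  core (suc (suc (2 ℕ.* i)))             ≡⟨ cong core (ℕ.*-suc 2 i) ⟨
  core (2 ℕ.* suc i)                     ≡⟨ core-even (suc i) ⟩
  suc i ℕ.* central (suc i)              ≡⟨ central-suc i ⟩
  2 ℕ.* suc (2 ℕ.* i) ℕ.* central i      ≡⟨ ℕ.*-assoc 2 (suc (2 ℕ.* i)) (central i) ⟩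
  2 ℕ.* (suc (2 ℕ.* i) ℕ.* central i)    ≡⟨ cong (2 ℕ.*_) (core-odd i) ⟨
  2 ℕ.* core (suc (2 ℕ.* i))             ∎
  where open ℕ.≤-Reasoning

-- Moments of 2 cos θ

-- `c` is `S e - 2 e`, with coefficients written as in `T-lin` so that linearity applies as it
-- stands.
e c : ℕ → ℤ
e w = + core w
c w = 1ℤ * e (suc w) + (- + 2) * e w

central-sucℤ : ∀ i → (1ℤ + + i) * + central (suc i) ≡ + 2 * (1ℤ + + 2 * + i) * + central i
central-sucℤ i = begin-equality
  + suc i * + central (suc i)                      ≡⟨ ℤ.pos-* (suc i) (central (suc i)) ⟨
  + (suc i ℕ.* central (suc i))                    ≡⟨ cong +_ (central-suc i) ⟩
  + (2 ℕ.* suc (2 ℕ.* i) ℕ.* central i)            ≡⟨ ℤ.pos-* (2 ℕ.* suc (2 ℕ.* i)) (central i) ⟩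
  + (2 ℕ.* suc (2 ℕ.* i)) * + central i            ≡⟨ cong (_* + central i) (ℤ.pos-* 2 (suc (2 ℕ.* i))) ⟩
  + 2 * (1ℤ + + (2 ℕ.* i)) * + central i           ≡⟨ cong (λ z → + 2 * (1ℤ + z) * + central i) (ℤ.pos-* 2 i) ⟩
  + 2 * (1ℤ + + 2 * + i) * + central i             ∎
  where open ℤ.≤-Reasoning

c-even : ∀ i → c (2 ℕ.* i) ≡ + central i
c-even i = trans (cong (λ z → 1ℤ * + z + (- + 2) * e (2 ℕ.* i)) (core-even-step i))
  (trans (cong (λ z → 1ℤ * (z + + central i) + (- + 2) * e (2 ℕ.* i)) (ℤ.pos-* 2 (core (2 ℕ.* i))))
         (ring (e (2 ℕ.* i)) (+ central i)))
  where
  ring : ∀ a b → 1ℤ * (+ 2 * a + b) + (- + 2) * a ≡ b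
  ring = solve-∀

c-odd : ∀ i → c (suc (2 ℕ.* i)) ≡ 0ℤ
c-odd i = trans (cong (λ z → 1ℤ * + z + (- + 2) * e (suc (2 ℕ.* i))) (core-odd-step i))
  (trans (cong (λ z → 1ℤ * z + (- + 2) * e (suc (2 ℕ.* i))) (ℤ.pos-* 2 (core (suc (2 ℕ.* i)))))
         (ring (e (suc (2 ℕ.* i)))))
  where
  ring : ∀ a → 1ℤ * (+ 2 * a) + (- + 2) * a ≡ 0ℤ
  ring = solve-∀

-- Integration by parts for monomials: for even `w` it is the recursion of the central binomials,
-- for odd `w` both sides vanish.
c-rec : ∀ w → (+ w + + 2) * c (suc (suc w)) ≡ + 4 * (+ w + 1ℤ) * c w
c-rec w with parity w
... | i , inj₁ refl = begin-equality
  (+ (2 ℕ.* i) + + 2) * c (suc (suc (2 ℕ.* i)))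
    ≡⟨ cong₂ (λ a b → (a + + 2) * b) (ℤ.pos-* 2 i) (trans (cong c (sym (ℕ.*-suc 2 i))) (c-even (suc i))) ⟩
  (+ 2 * + i + + 2) * + central (suc i)     ≡⟨ ring₁ (+ i) (+ central (suc i)) ⟩
  + 2 * ((1ℤ + + i) * + central (suc i))    ≡⟨ cong (+ 2 *_) (central-sucℤ i) ⟩
  + 2 * (+ 2 * (1ℤ + + 2 * + i) * + central i)  ≡⟨ ring₂ (+ i) (+ central i) ⟩
  + 4 * (+ 2 * + i + 1ℤ) * + central i      ≡⟨ cong₂ (λ a b → + 4 * (a + 1ℤ) * b) (ℤ.pos-* 2 i) (c-even i) ⟨
  + 4 * (+ (2 ℕ.* i) + 1ℤ) * c (2 ℕ.* i)    ∎
  where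
  open ℤ.≤-Reasoning
  ring₁ : ∀ i k → (+ 2 * i + + 2) * k ≡ + 2 * ((1ℤ + i) * k)
  ring₁ = solve-∀
  ring₂ : ∀ i k → + 2 * (+ 2 * (1ℤ + + 2 * i) * k) ≡ + 4 * (+ 2 * i + 1ℤ) * k
  ring₂ = solve-∀
... | i , inj₂ refl = trans
  (cong (_*_ (+ suc (2 ℕ.* i) + + 2)) (trans (cong (λ k → c (suc k)) (sym (ℕ.*-suc 2 i))) (c-odd (suc i))))
  (trans (ring (+ suc (2 ℕ.* i) + + 2) (+ 4 * (+ suc (2 ℕ.* i) + 1ℤ))) (cong (_*_ (+ 4 * (+ suc (2 ℕ.* i) + 1ℤ))) (sym (c-odd i))))
  where
  ring : ∀ a b → a * 0ℤ ≡ b * 0ℤ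
  ring = solve-∀

-- The shift multiplies the integrand of a moment by `x = 2 cos θ`, so this is the mean of
-- `x^w (2+x)^p (2-x)^q`.
H : ℕ → ℕ → ℕ → ℤ
H p q w = T (+ 2) p q c w

-- The mean of (4 − x²) g′(x) − x g(x) at x = 2 cos θ, for g = x^(w+1) (2+x)^p (2−x)^q, where h₀, h₁, h₂
-- are H p q w, H p q (w+1), H p q (w+2); ibp₀ is the case g = (2+x)^p (2−x)^q.
ibp : ℤ → ℤ → ℤ → ℤ → ℤ → ℤ → ℤ
ibp p q w h₀ h₁ h₂ = p * (+ 2 * h₁ + - h₂) + - (q * (+ 2 * h₁ + h₂)) + (w + 1ℤ) * (+ 4 * h₀ + - h₂) + - h₂

ibp₀ : ℤ → ℤ → ℤ → ℤ → ℤ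
ibp₀ p q h₀ h₁ = p * (+ 2 * h₀ + - h₁) + - (q * (+ 2 * h₀ + h₁)) + - h₁

-- The `ibp` expression is linear in g. Multiplying g by `2 + x` or `2 - x` gives twice the
-- expression at `w` plus or minus the one at `w + 1`, so induction on `p` and `q` reduces
-- everything to `c-rec`.
H-ibp : ∀ p q w → ibp (+ p) (+ q) (+ w) (H p q w) (H p q (suc w)) (H p q (suc (suc w))) ≡ 0ℤ
H-ibp zero zero w = trans (ring (+ w) (c w) (c (suc w)) (c (suc (suc w))))
  (trans (cong (λ z → + 4 * (+ w + 1ℤ) * c w + - z) (c-rec w)) (ℤ.+-inverseʳ (+ 4 * (+ w + 1ℤ) * c w)))
  where
  ring : ∀ w h₀ h₁ h₂ → 0ℤ * (+ 2 * h₁ + - h₂) + - (0ℤ * (+ 2 * h₁ + h₂)) + (w + 1ℤ) * (+ 4 * h₀ + - h₂) + - h₂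
    ≡ + 4 * (w + 1ℤ) * h₀ + - ((w + + 2) * h₂)
  ring = solve-∀
H-ibp zero (suc q) w = trans
  (ring (+ q) (+ w) (H 0 q w) (H 0 q (suc w)) (H 0 q (suc (suc w))) (H 0 q (suc (suc (suc w)))))
  (cong₂ (λ a b → + 2 * a + - b) (H-ibp zero q w) (H-ibp zero q (suc w)))
  where
  ring : ∀ q w h₀ h₁ h₂ h₃ →
    0ℤ * (+ 2 * (+ 2 * h₁ + - h₂) + - (+ 2 * h₂ + - h₃)) + - ((1ℤ + q) * (+ 2 * (+ 2 * h₁ + - h₂) + (+ 2 * h₂ + - h₃)))
      + (w + 1ℤ) * (+ 4 * (+ 2 * h₀ + - h₁) + - (+ 2 * h₂ + - h₃)) + - (+ 2 * h₂ + - h₃)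
    ≡ + 2 * (0ℤ * (+ 2 * h₁ + - h₂) + - (q * (+ 2 * h₁ + h₂)) + (w + 1ℤ) * (+ 4 * h₀ + - h₂) + - h₂)
      + - (0ℤ * (+ 2 * h₂ + - h₃) + - (q * (+ 2 * h₂ + h₃)) + ((1ℤ + w) + 1ℤ) * (+ 4 * h₁ + - h₃) + - h₃)
  ring = solve-∀
H-ibp (suc p) q w = trans
  (ring (+ p) (+ q) (+ w) (H p q w) (H p q (suc w)) (H p q (suc (suc w))) (H p q (suc (suc (suc w)))))
  (cong₂ (λ a b → + 2 * a + b) (H-ibp p q w) (H-ibp p q (suc w)))
  where
  ring : ∀ p q w h₀ h₁ h₂ h₃ →
    (1ℤ + p) * (+ 2 * (+ 2 * h₁ + h₂) + - (+ 2 * h₂ + h₃)) + - (q * (+ 2 * (+ 2 * h₁ + h₂) + (+ 2 * h₂ + h₃)))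
      + (w + 1ℤ) * (+ 4 * (+ 2 * h₀ + h₁) + - (+ 2 * h₂ + h₃)) + - (+ 2 * h₂ + h₃)
    ≡ + 2 * (p * (+ 2 * h₁ + - h₂) + - (q * (+ 2 * h₁ + h₂)) + (w + 1ℤ) * (+ 4 * h₀ + - h₂) + - h₂)
      + (p * (+ 2 * h₂ + - h₃) + - (q * (+ 2 * h₂ + h₃)) + ((1ℤ + w) + 1ℤ) * (+ 4 * h₁ + - h₃) + - h₃)
  ring = solve-∀

-- `H-ibp` covers only g with a factor x. Without that factor the same induction works, the multiple
-- by x being supplied by `H-ibp` at `w = 0`.
H-ibp₀ : ∀ p q → ibp₀ (+ p) (+ q) (H p q 0) (H p q 1) ≡ 0ℤ
H-ibp₀ zero zero = refl
H-ibp₀ zero (suc q) = trans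
  (ring (+ q) (H 0 q 0) (H 0 q 1) (H 0 q 2))
  (cong₂ (λ a b → + 2 * a + - b) (H-ibp₀ zero q) (H-ibp zero q 0))
  where
  ring : ∀ q h₀ h₁ h₂ →
    0ℤ * (+ 2 * (+ 2 * h₀ + - h₁) + - (+ 2 * h₁ + - h₂)) + - ((1ℤ + q) * (+ 2 * (+ 2 * h₀ + - h₁) + (+ 2 * h₁ + - h₂)))
      + - (+ 2 * h₁ + - h₂)
    ≡ + 2 * (0ℤ * (+ 2 * h₀ + - h₁) + - (q * (+ 2 * h₀ + h₁)) + - h₁)
      + - (0ℤ * (+ 2 * h₁ + - h₂) + - (q * (+ 2 * h₁ + h₂)) + (0ℤ + 1ℤ) * (+ 4 * h₀ + - h₂) + - h₂)
  ring = solve-∀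
H-ibp₀ (suc p) q = trans
  (ring (+ p) (+ q) (H p q 0) (H p q 1) (H p q 2))
  (cong₂ (λ a b → + 2 * a + b) (H-ibp₀ p q) (H-ibp p q 0))
  where
  ring : ∀ p q h₀ h₁ h₂ →
    (1ℤ + p) * (+ 2 * (+ 2 * h₀ + h₁) + - (+ 2 * h₁ + h₂)) + - (q * (+ 2 * (+ 2 * h₀ + h₁) + (+ 2 * h₁ + h₂)))
      + - (+ 2 * h₁ + h₂)
    ≡ + 2 * (p * (+ 2 * h₀ + - h₁) + - (q * (+ 2 * h₀ + h₁)) + - h₁)
      + (p * (+ 2 * h₁ + - h₂) + - (q * (+ 2 * h₁ + h₂)) + (0ℤ + 1ℤ) * (+ 4 * h₀ + - h₂) + - h₂)
  ring = solve-∀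

H₁ : ∀ p q → (1ℤ + + p + + q) * H p q 1 ≡ + 2 * (+ p + - + q) * H p q 0
H₁ p q = ℤ.i-j≡0⇒i≡j _ _ (trans
  (ring (+ p) (+ q) (H p q 0) (H p q 1)) (cong -_ (H-ibp₀ p q)))
  where
  ring : ∀ p q h₀ h₁ → (1ℤ + p + q) * h₁ + - (+ 2 * (p + - q) * h₀) ≡ - (p * (+ 2 * h₀ + - h₁) + - (q * (+ 2 * h₀ + h₁)) + - h₁)
  ring = solve-∀

-- `H (suc p) q 0` unfolds to `2 H p q 0 + H p q 1`, and `H₁` eliminates the first moment.
H-sucˡ : ∀ p q → (1ℤ + + p + + q) * H (suc p) q 0 ≡ + 2 * (1ℤ + + 2 * + p) * H p q 0
H-sucˡ p q = trans (ring₁ (1ℤ + + p + + q) (H p q 0) (H p q 1))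
  (trans (cong (_+_ (+ 2 * (1ℤ + + p + + q) * H p q 0)) (H₁ p q)) (ring₂ (+ p) (+ q) (H p q 0)))
  where
  ring₁ : ∀ k h₀ h₁ → k * (+ 2 * h₀ + h₁) ≡ + 2 * k * h₀ + k * h₁
  ring₁ = solve-∀
  ring₂ : ∀ p q h → + 2 * (1ℤ + p + q) * h + + 2 * (p + - q) * h ≡ + 2 * (1ℤ + + 2 * p) * h
  ring₂ = solve-∀

H-sucʳ : ∀ p q → (1ℤ + + p + + q) * H p (suc q) 0 ≡ + 2 * (1ℤ + + 2 * + q) * H p q 0
H-sucʳ p q = trans (cong ((1ℤ + + p + + q) *_) (T-minus (+ 2) p q c 0))
  (trans (ring₁ (1ℤ + + p + + q) (H p q 0) (H p q 1))
  (trans (cong (λ z → + 2 * (1ℤ + + p + + q) * H p q 0 + - z) (H₁ p q)) (ring₂ (+ p) (+ q) (H p q 0))))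
  where
  ring₁ : ∀ k h₀ h₁ → k * (+ 2 * h₀ + - h₁) ≡ + 2 * k * h₀ + - (k * h₁)
  ring₁ = solve-∀
  ring₂ : ∀ p q h → + 2 * (1ℤ + p + q) * h + - (+ 2 * (p + - q) * h) ≡ + 2 * (1ℤ + + 2 * q) * h
  ring₂ = solve-∀

0≤k*j : ∀ k {j} → .⦃ ℤ.NonNegative k ⦄ → 0ℤ ≤ j → 0ℤ ≤ k * j
0≤k*j k {j} h = subst (_≤ k * j) (ℤ.*-zeroʳ k) (ℤ.*-monoˡ-≤-nonNeg k h)

0≤k*j⇒0≤j : ∀ k {j} → .⦃ ℤ.Positive k ⦄ → 0ℤ ≤ k * j → 0ℤ ≤ j
0≤k*j⇒0≤j k {j} h = ℤ.*-cancelˡ-≤-pos 0ℤ j k (subst (_≤ k * j) (sym (ℤ.*-zeroʳ k)) h)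

0≤2[1+2p] : ∀ p {j} → 0ℤ ≤ j → 0ℤ ≤ + 2 * (1ℤ + + 2 * + p) * j
0≤2[1+2p] p {j} h = subst (λ k → 0ℤ ≤ k * j)
  (trans (ℤ.pos-* 2 (suc (2 ℕ.* p))) (cong (λ z → + 2 * (1ℤ + z)) (ℤ.pos-* 2 p)))
  (0≤k*j (+ (2 ℕ.* suc (2 ℕ.* p))) h)

-- The recurrences have positive coefficients on both sides, so positivity follows without any
-- integral.
H-nonNeg : ∀ p q → 0ℤ ≤ H p q 0
H-nonNeg zero    zero    = +≤+ z≤n
H-nonNeg zero    (suc q) = 0≤k*j⇒0≤j (1ℤ + + 0 + + q)
  (subst (0ℤ ≤_) (sym (H-sucʳ 0 q)) (0≤2[1+2p] q (H-nonNeg 0 q)))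
H-nonNeg (suc p) q       = 0≤k*j⇒0≤j (1ℤ + + p + + q)
  (subst (0ℤ ≤_) (sym (H-sucˡ p q)) (0≤2[1+2p] p (H-nonNeg p q)))

0≤H₁ : ∀ {p q} → q ℕ.≤ p → 0ℤ ≤ H p q 1
0≤H₁ {p} {q} q≤p = 0≤k*j⇒0≤j (1ℤ + + p + + q) (subst (0ℤ ≤_) (sym (H₁ p q))
  (subst (0ℤ ≤_) (sym (ℤ.*-assoc (+ 2) (+ p + - + q) (H p q 0)))
    (0≤k*j (+ 2) (0≤k*j (+ p + - + q) ⦃ ℤ.nonNegative (ℤ.i≤j⇒0≤j-i (+≤+ q≤p)) ⦄ (H-nonNeg p q)))))

H₁≤0 : ∀ {p q} → p ℕ.≤ q → 0ℤ ≤ - H p q 1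
H₁≤0 {p} {q} p≤q = 0≤k*j⇒0≤j (1ℤ + + p + + q) (subst (0ℤ ≤_)
  (sym (trans (ring₁ (1ℤ + + p + + q) (H p q 1)) (trans (cong -_ (H₁ p q)) (ring₂ (+ p) (+ q) (H p q 0)))))
    (0≤k*j (+ 2) (0≤k*j (+ q + - + p) ⦃ ℤ.nonNegative (ℤ.i≤j⇒0≤j-i (+≤+ p≤q)) ⦄ (H-nonNeg p q))))
  where
  ring₁ : ∀ k h → k * (- h) ≡ - (k * h)
  ring₁ = solve-∀
  ring₂ : ∀ p q h → - (+ 2 * (p + - q) * h) ≡ + 2 * ((q + - p) * h)
  ring₂ = solve-∀

-- The two sides are `2 H p q 0 - H p q 1` and `2 H p q 0 + H p q 1`, and `H₁` makes `H p q 1`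
-- nonnegative for `q ≤ p`.
H-stepˡ : ∀ {p q} → q ℕ.≤ p → H p (suc q) 0 ≤ H (suc p) q 0
H-stepˡ {p} {q} q≤p = subst (_≤ H (suc p) q 0) (sym (T-minus (+ 2) p q c 0))
  (ℤ.+-monoʳ-≤ (+ 2 * H p q 0) (ℤ.≤-trans (ℤ.neg-mono-≤ (0≤H₁ {p} {q} q≤p)) (0≤H₁ {p} {q} q≤p)))

H-stepʳ : ∀ {p q} → p ℕ.≤ q → H (suc p) q 0 ≤ H p (suc q) 0
H-stepʳ {p} {q} p≤q = subst (H (suc p) q 0 ≤_) (sym (T-minus (+ 2) p q c 0))
  (ℤ.+-monoʳ-≤ (+ 2 * H p q 0) (ℤ.≤-trans
    (subst (_≤ 0ℤ) (ℤ.neg-involutive (H p q 1)) (ℤ.neg-mono-≤ (H₁≤0 {p} {q} p≤q))) (H₁≤0 {p} {q} p≤q)))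

-- Moves `i` factors one at a time, away from the diagonal; the hypothesis keeps every intermediate
-- pair on the side where `H-stepˡ` applies.
H-moveˡ : ∀ i p q → q ℕ.+ i ℕ.≤ p → H p (q ℕ.+ i) 0 ≤ H (p ℕ.+ i) q 0
H-moveˡ zero    p q h rewrite ℕ.+-identityʳ q | ℕ.+-identityʳ p = ℤ.≤-refl
H-moveˡ (suc i) p q h rewrite ℕ.+-suc q i | ℕ.+-suc p i =
  ℤ.≤-trans (H-moveˡ i p (suc q) h)
    (H-stepˡ {p ℕ.+ i} {q} (ℕ.≤-trans (ℕ.m≤m+n q i) (ℕ.≤-trans (ℕ.n≤1+n _) (ℕ.≤-trans h (ℕ.m≤m+n p i)))))

H-moveʳ : ∀ i p q → p ℕ.+ i ℕ.≤ q → H (p ℕ.+ i) q 0 ≤ H p (q ℕ.+ i) 0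
H-moveʳ zero    p q h rewrite ℕ.+-identityʳ q | ℕ.+-identityʳ p = ℤ.≤-refl
H-moveʳ (suc i) p q h rewrite ℕ.+-suc q i | ℕ.+-suc p i =
  ℤ.≤-trans (H-moveʳ i (suc p) q h)
    (H-stepʳ {p} {q ℕ.+ i} (ℕ.≤-trans (ℕ.m≤m+n p i) (ℕ.≤-trans (ℕ.n≤1+n _) (ℕ.≤-trans h (ℕ.m≤m+n q i)))))

central-unique : ∀ (f : ℕ → ℤ) → f 0 ≡ 1ℤ →
  (∀ i → (1ℤ + + i) * f (suc i) ≡ + 2 * (1ℤ + + 2 * + i) * f i) → ∀ i → f i ≡ + central i
central-unique f h₀ h zero    = h₀
central-unique f h₀ h (suc i) = ℤ.*-cancelˡ-≡ (1ℤ + + i) (f (suc i)) (+ central (suc i))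
  (trans (h i) (trans (cong (λ z → + 2 * (1ℤ + + 2 * + i) * z) (central-unique f h₀ h i)) (sym (central-sucℤ i))))

H-left : ∀ p → H p 0 0 ≡ + central p
H-left = central-unique (λ p → H p 0 0) refl λ p →
  trans (cong (_* H (suc p) 0 0) (sym (ℤ.+-identityʳ (1ℤ + + p)))) (H-sucˡ p 0)

-- A step in each index passes through `H m (suc m) 0`. The factor `1 + 2m` on the right of the
-- first step is the left coefficient of the second, which leaves the recursion of the central
-- binomials.
H-diagonal : ∀ m → H m m 0 ≡ + central m
H-diagonal = central-unique (λ m → H m m 0) refl λ m →
  ℤ.*-cancelˡ-≡ (+ 2) _ _ (begin-equality
    + 2 * ((1ℤ + + m) * H (suc m) (suc m) 0)          ≡⟨ ring₁ (+ m) (H (suc m) (suc m) 0) ⟩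
    (1ℤ + + m + (1ℤ + + m)) * H (suc m) (suc m) 0     ≡⟨ H-sucˡ m (suc m) ⟩
    + 2 * (1ℤ + + 2 * + m) * H m (suc m) 0            ≡⟨ ring₂ (+ m) (H m (suc m) 0) ⟩
    + 2 * ((1ℤ + + m + + m) * H m (suc m) 0)          ≡⟨ cong (+ 2 *_) (H-sucʳ m m) ⟩
    + 2 * (+ 2 * (1ℤ + + 2 * + m) * H m m 0)          ∎)
  where
  open ℤ.≤-Reasoning
  ring₁ : ∀ m h → + 2 * ((1ℤ + m) * h) ≡ (1ℤ + m + (1ℤ + m)) * h
  ring₁ = solve-∀
  ring₂ : ∀ m h → + 2 * (1ℤ + + 2 * m) * h ≡ + 2 * ((1ℤ + m + m) * h)
  ring₂ = solve-∀

-- On the line `p + q = 2m` every pair is reached from `(m, m)` by moving `i` factors outwards, and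
-- each move can only increase `H`.
central≤H : ∀ m p q → p ℕ.+ q ≡ m ℕ.+ m → + central m ≤ H p q 0
central≤H m p q s with ℕ.≤-total q m
... | inj₁ q≤m with ℕ.m≤n⇒∃[o]m+o≡n q≤m
...   | i , refl = subst₂ _≤_ (H-diagonal (q ℕ.+ i)) (cong (λ k → H k q 0) p≡)
        (H-moveˡ i (q ℕ.+ i) q ℕ.≤-refl)
  where
  ring : ∀ q i → q ℕ.+ i ℕ.+ i ℕ.+ q ≡ q ℕ.+ i ℕ.+ (q ℕ.+ i)
  ring = solve-∀ℕ
  p≡ : q ℕ.+ i ℕ.+ i ≡ p
  p≡ = ℕ.+-cancelʳ-≡ q _ _ (trans (ring q i) (sym s))
central≤H m p q s | inj₂ m≤q with ℕ.m≤n⇒∃[o]m+o≡n m≤q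
... | i , refl = subst₂ _≤_ (trans (cong (λ k → H k m 0) p≡) (H-diagonal m)) refl
        (H-moveʳ i p m (ℕ.≤-reflexive p≡))
  where
  ring : ∀ p m i → p ℕ.+ i ℕ.+ m ≡ p ℕ.+ (m ℕ.+ i)
  ring = solve-∀ℕ
  p≡ : p ℕ.+ i ≡ m
  p≡ = ℕ.+-cancelʳ-≡ m _ _ (trans (ring p m i) s)

T-e : ∀ p q w → T (+ 2) p q e (suc w) ≡ H p q w + + 2 * T (+ 2) p q e w
T-e p q w = sym (trans
  (cong (_+ + 2 * T (+ 2) p q e w) (trans (T-lin (+ 2) p q 1ℤ (- + 2) (λ v → e (suc v)) e w)
    (cong (λ z → 1ℤ * z + (- + 2) * T (+ 2) p q e w) (T-shift (+ 2) p q e w))))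
  (ring (T (+ 2) p q e (suc w)) (T (+ 2) p q e w)))
  where
  ring : ∀ a b → 1ℤ * a + (- + 2) * b + + 2 * b ≡ a
  ring = solve-∀

-- As `(2 - S) e = - c`, a single factor `2 - S` leaves only moments; these are the nontrivial
-- eigenvalues of λ.
T-e-minus : ∀ p q → T (+ 2) p (suc q) e 0 ≡ - H p q 0
T-e-minus p q = trans (T-minus (+ 2) p q e 0)
  (trans (cong (λ z → + 2 * T (+ 2) p q e 0 + - z) (T-e p q 0)) (ring (T (+ 2) p q e 0) (H p q 0)))
  where
  ring : ∀ a b → + 2 * a + - (b + + 2 * a) ≡ - b
  ring = solve-∀

-- The trivial eigenvalue is `2^n` times `Λ n`, doubled here to avoid fractions. A further factor
-- `2 + S` multiplies it by 4 and adds `H n 0 0`.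
T-e-plus : ∀ n → + 2 * T (+ 2) n 0 e 0 ≡ + n * + central n
T-e-plus zero    = refl
T-e-plus (suc n) = begin-equality
  + 2 * (+ 2 * t + T (+ 2) n 0 e 1)                  ≡⟨ cong (λ z → + 2 * (+ 2 * t + z)) (T-e n 0 0) ⟩
  + 2 * (+ 2 * t + (H n 0 0 + + 2 * t))              ≡⟨ ring₁ t (H n 0 0) ⟩
  + 4 * (+ 2 * t) + + 2 * H n 0 0                    ≡⟨ cong₂ (λ a b → + 4 * a + + 2 * b) (T-e-plus n) (H-left n) ⟩
  + 4 * (+ n * + central n) + + 2 * + central n      ≡⟨ ring₂ (+ n) (+ central n) ⟩
  + 2 * (1ℤ + + 2 * + n) * + central n               ≡⟨ central-sucℤ n ⟨
  + suc n * + central (suc n)                        ∎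
  where
  open ℤ.≤-Reasoning
  t = T (+ 2) n 0 e 0
  ring₁ : ∀ t h → + 2 * (+ 2 * t + (h + + 2 * t)) ≡ + 4 * (+ 2 * t) + + 2 * h
  ring₁ = solve-∀
  ring₂ : ∀ n k → + 4 * (n * k) + + 2 * k ≡ + 2 * (1ℤ + + 2 * n) * k
  ring₂ = solve-∀

-- The identity kernel and pair sums of a code

δ : ℕ → ℤ
δ zero    = 1ℤ
δ (suc _) = 0ℤ

T-δ-suc : ∀ r p q w → T r p q δ (suc w) ≡ 0ℤ
T-δ-suc r zero    zero    w = refl
T-δ-suc r zero    (suc q) w = trans
  (cong₂ (λ a b → r * a + - b) (T-δ-suc r zero q w) (T-δ-suc r zero q (suc w)))
  (trans (ℤ.+-identityʳ (r * 0ℤ)) (ℤ.*-zeroʳ r))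
T-δ-suc r (suc p) q       w = trans
  (cong₂ (λ a b → r * a + b) (T-δ-suc r p q w) (T-δ-suc r p q (suc w)))
  (trans (ℤ.+-identityʳ (r * 0ℤ)) (ℤ.*-zeroʳ r))

-- The kernel of `δ` is a power of `r` times the identity, so all its eigenvalues coincide.
T-δ : ∀ r p q → T r p q δ 0 ≡ r ℤ.^ (p ℕ.+ q)
T-δ r zero    zero    = refl
T-δ r zero    (suc q) = trans
  (cong₂ (λ a b → r * a + - b) (T-δ r zero q) (T-δ-suc r zero q 0)) (ℤ.+-identityʳ (r * r ℤ.^ q))
T-δ r (suc p) q       = trans
  (cong₂ (λ a b → r * a + b) (T-δ r p q) (T-δ-suc r p q 0)) (ℤ.+-identityʳ (r * r ℤ.^ (p ℕ.+ q)))

pairs : ∀ {n} → List (Point n) → (ℕ → ℤ) → ℤ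
pairs Z φ = ∑ Z λ x → ∑ Z λ y → φ (hamming x y)

pairs-mono : ∀ {n} (Z : List (Point n)) {φ ψ} → (∀ w → w ℕ.≤ n → φ w ≤ ψ w) → pairs Z φ ≤ pairs Z ψ
pairs-mono Z h = ∑-mono Z λ x → ∑-mono Z λ y → h (hamming x y) (hamming≤n x y)

pairs-cong : ∀ {n} (Z : List (Point n)) {φ ψ} → (∀ w → φ w ≡ ψ w) → pairs Z φ ≡ pairs Z ψ
pairs-cong Z h = ∑-cong Z λ x → ∑-cong Z λ y → h (hamming x y)

pairs-lin : ∀ {n} (Z : List (Point n)) k l φ ψ →
  pairs Z (λ w → k * φ w + l * ψ w) ≡ k * pairs Z φ + l * pairs Z ψ
pairs-lin Z k l φ ψ = trans (∑-cong Z λ x → ∑-lin (λ y → φ (hamming x y)) (λ y → ψ (hamming x y)))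
  (∑-lin (λ x → ∑ Z λ y → φ (hamming x y)) (λ x → ∑ Z λ y → ψ (hamming x y)))
  where
  ∑-lin : ∀ f g → ∑ Z (λ a → k * f a + l * g a) ≡ k * ∑ Z f + l * ∑ Z g
  ∑-lin f g = trans (∑-+ Z (λ a → k * f a) (λ a → l * g a)) (cong₂ _+_ (∑-*ˡ Z k f) (∑-*ˡ Z l g))

pairs-1 : ∀ {n} (Z : List (Point n)) → pairs Z (λ _ → 1ℤ) ≡ + length Z * + length Z
pairs-1 Z = trans (∑-cong Z λ _ → trans (∑-1 Z) (sym (ℤ.*-identityʳ (+ length Z))))
  (trans (∑-*ˡ Z (+ length Z) (λ _ → 1ℤ)) (cong (+ length Z *_) (∑-1 Z)))

pairs-lam : ∀ n (Z : List (Point n)) → pairs Z (λ w → + lam n w) ≡ + pairSum n Z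
pairs-lam n Z = trans (∑-cong Z λ x → ∑-pos Z (λ y → lam n (hamming x y)))
  (∑-pos Z (λ x → sum (map (λ y → lam n (hamming x y)) Z)))
  where
  ∑-pos : ∀ (L : List (Point n)) f → ∑ L (λ a → + f a) ≡ + sum (map f L)
  ∑-pos []      f = refl
  ∑-pos (a ∷ L) f = cong (_+_ (+ f a)) (∑-pos L f)

hamming-refl : ∀ {n} (x : Point n) → hamming x x ≡ 0
hamming-refl []          = refl
hamming-refl (true ∷ x)  = hamming-refl x
hamming-refl (false ∷ x) = hamming-refl x

hamming≡0⇒≡ : ∀ {n} (x y : Point n) → hamming x y ≡ 0 → x ≡ y
hamming≡0⇒≡ []          []          h = refl
hamming≡0⇒≡ (true ∷ x)  (true ∷ y)  h = cong (true ∷_) (hamming≡0⇒≡ x y h)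
hamming≡0⇒≡ (false ∷ x) (false ∷ y) h = cong (false ∷_) (hamming≡0⇒≡ x y h)

δ-hamming : ∀ {n} {x y : Point n} → x ≢ y → δ (hamming x y) ≡ 0ℤ
δ-hamming {x = x} {y} x≢y with hamming x y in eq
... | zero  = contradiction (hamming≡0⇒≡ x y eq) x≢y
... | suc _ = refl

∑-zero : ∀ {A : Set} (L : List A) {f} → All (λ a → f a ≡ 0ℤ) L → ∑ L f ≡ 0ℤ
∑-zero []      []      = refl
∑-zero (a ∷ L) (h ∷ k) = cong₂ _+_ h (∑-zero L k)

pairs-δ : ∀ {n} (Z : List (Point n)) → Unique Z → pairs Z δ ≡ + length Z
pairs-δ []      []      = refl
pairs-δ (z ∷ Z) (h ∷ u) = begin-equality
  (δ (hamming z z) + ∑ Z (λ y → δ (hamming z y))) + ∑ Z (λ x → δ (hamming x z) + ∑ Z (λ y → δ (hamming x y)))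
    ≡⟨ cong₂ _+_ (cong₂ _+_ (cong δ (hamming-refl z)) (∑-zero Z (All.map δ-hamming h)))
                 (∑-+ Z (λ x → δ (hamming x z)) (λ x → ∑ Z (λ y → δ (hamming x y)))) ⟩
  (1ℤ + 0ℤ) + (∑ Z (λ x → δ (hamming x z)) + pairs Z δ)
    ≡⟨ cong₂ (λ a b → 1ℤ + (a + b)) (∑-zero Z (All.map (λ z≢x → δ-hamming λ x≡z → z≢x (sym x≡z)) h)) (pairs-δ Z u) ⟩
  1ℤ + (0ℤ + + length Z)
    ≡⟨⟩
  + suc (length Z) ∎
  where open ℤ.≤-Reasoning

pos-^ : ∀ m n → + (m ℕ.^ n) ≡ (+ m) ℤ.^ n
pos-^ m zero    = refl
pos-^ m (suc n) = trans (ℤ.pos-* m (m ℕ.^ n)) (cong (+ m *_) (pos-^ m n))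

pairs-bound : ∀ r {n} f (Z : List (Point n)) →
  (∀ p q → p ℕ.+ q ℕ.+ 1 ≡ n → T r p (suc q) f 0 ≤ 0ℤ) →
  + (2 ℕ.^ n) * pairs Z (λ w → r ℤ.^ (n ∸ w) * f w) ≤ T r n 0 f 0 * (+ length Z * + length Z)
pairs-bound r {n} f Z h = subst₂ _≤_
  (cong₂ _*_ (sym (pos-^ 2 n)) (∑-cong Z λ x → ∑-cong Z λ y → ℤ.*-identityˡ _))
  (cong (T r n 0 f 0 *_) (cong₂ _*_ (∑-1 Z) (∑-1 Z)))
  (form-bound r n f Z (λ _ → 1ℤ) id h)

-- The nontrivial eigenvalues of `k e + l δ` are `l 2^n - k H p q 0`, so the hypothesis is their
-- nonpositivity. On the diagonal `δ` adds `l 2^n`, counted once per point because the points are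
-- distinct.
pairs-eδ : ∀ {n} k l (Z : List (Point n)) → Unique Z →
  (∀ p q → p ℕ.+ q ℕ.+ 1 ≡ n → l * + (2 ℕ.^ n) ≤ k * H p q 0) →
  + (2 ℕ.^ n) * (k * + pairSum n Z + l * + (2 ℕ.^ n) * + length Z)
    ≤ (k * T (+ 2) n 0 e 0 + l * + (2 ℕ.^ n)) * (+ length Z * + length Z)
pairs-eδ {n} k l Z u h = subst₂ _≤_
  (cong (+ (2 ℕ.^ n) *_) sum-eq)
  (cong (_* (+ length Z * + length Z)) (trans (T-lin (+ 2) n 0 k l e δ 0)
    (cong (λ z → k * T (+ 2) n 0 e 0 + l * z) (trans (T-δ (+ 2) n 0) (trans (cong ((+ 2) ℤ.^_) (ℕ.+-identityʳ n)) (sym (pos-^ 2 n)))))))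
  (pairs-bound (+ 2) f Z cond)
  where
  f : ℕ → ℤ
  f v = k * e v + l * δ v
  ring₁ : ∀ p k l a b → p * (k * a + l * b) ≡ k * (p * a) + l * (p * b)
  ring₁ = solve-∀
  δ-pow : ∀ w → (+ 2) ℤ.^ (n ∸ w) * δ w ≡ + (2 ℕ.^ n) * δ w
  δ-pow zero    = cong (_* 1ℤ) (sym (pos-^ 2 n))
  δ-pow (suc w) = trans (ℤ.*-zeroʳ ((+ 2) ℤ.^ (n ∸ suc w))) (sym (ℤ.*-zeroʳ (+ (2 ℕ.^ n))))
  pt : ∀ w → (+ 2) ℤ.^ (n ∸ w) * f w ≡ k * + lam n w + l * + (2 ℕ.^ n) * δ w
  pt w = trans (ring₁ ((+ 2) ℤ.^ (n ∸ w)) k l (e w) (δ w)) (cong₂ (λ a b → k * a + b)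
    (trans (cong (_* e w) (sym (pos-^ 2 (n ∸ w)))) (trans (sym (ℤ.pos-* (2 ℕ.^ (n ∸ w)) (core w))) (cong +_ (sym (lam≡core n w)))))
    (trans (cong (l *_) (δ-pow w)) (sym (ℤ.*-assoc l (+ (2 ℕ.^ n)) (δ w)))))
  sum-eq : pairs Z (λ w → (+ 2) ℤ.^ (n ∸ w) * f w) ≡ k * + pairSum n Z + l * + (2 ℕ.^ n) * + length Z
  sum-eq = trans (pairs-cong Z pt) (trans (pairs-lin Z k (l * + (2 ℕ.^ n)) (λ w → + lam n w) δ)
    (cong₂ (λ a b → k * a + l * + (2 ℕ.^ n) * b) (pairs-lam n Z) (pairs-δ Z u)))
  ring₂ : ∀ k h l → k * (- h) + l ≡ l + - (k * h)
  ring₂ = solve-∀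
  cond : ∀ p q → p ℕ.+ q ℕ.+ 1 ≡ n → T (+ 2) p (suc q) f 0 ≤ 0ℤ
  cond p q s = subst (_≤ 0ℤ)
    (sym (trans (T-lin (+ 2) p (suc q) k l e δ 0) (trans
      (cong₂ (λ a b → k * a + l * b) (T-e-minus p q)
        (trans (T-δ (+ 2) p (suc q)) (trans (cong ((+ 2) ℤ.^_) (trans (trans (ℕ.+-suc p q) (ℕ.+-comm 1 (p ℕ.+ q))) s)) (sym (pos-^ 2 n)))))
      (ring₂ k (H p q 0) (l * + (2 ℕ.^ n))))))
    (ℤ.i≤j⇒i-j≤0 (h p q s))

0<2^ : ∀ n → ℤ.Positive (+ (2 ℕ.^ n))
0<2^ n with 2 ℕ.^ n | ℕ.m^n>0 2 n
... | suc _ | _ = _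

-- The eigenvalues of the kernel −δ are all negative, so pairs-eδ applies with k = 0, l = −1.
length≤2^n : ∀ {n} (Z : List (Point n)) → Unique Z → length Z ℕ.≤ 2 ℕ.^ n
length≤2^n []        _ = z≤n
length≤2^n {n} Z@(_ ∷ _) u = ℤ.drop‿+≤+ (ℤ.*-cancelˡ-≤-pos (+ N) P (P * + N) ⦃ pos-PN ⦄
  (ℤ.neg-cancel-≤ (subst₂ _≤_ (ring₁ P (+ N) (+ pairSum n Z)) (ring₂ P (+ N) (T (+ 2) n 0 e 0))
    (pairs-eδ 0ℤ (- 1ℤ) Z u λ p q s → neg p q))))
  where
  N = length Z
  P = + (2 ℕ.^ n)
  pos-PN : ℤ.Positive (P * + N)
  pos-PN = ℤ.positive (subst (ℤ._< P * + N) (ℤ.*-zeroʳ P) (ℤ.*-monoˡ-<-pos P ⦃ 0<2^ n ⦄ (ℤ.positive⁻¹ (+ N))))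
  ring₁ : ∀ P N s → P * (0ℤ * s + - 1ℤ * P * N) ≡ - (P * N * P)
  ring₁ = solve-∀
  ring₂ : ∀ P N t → (0ℤ * t + - 1ℤ * P) * (N * N) ≡ - (P * N * N)
  ring₂ = solve-∀
  neg : ∀ p q → - 1ℤ * P ≤ 0ℤ * H p q 0
  neg p q = subst (_≤ 0ℤ) (sym (ℤ.-1*i≡-i P)) (ℤ.neg-mono-≤ (+≤+ z≤n))

-- With `k = 2^n` a factor `2^n` cancels, and `central m` is what is added to λ at distance 0. No
-- larger amount would do, since `H m m 0` equals it.
spectral-bound : ∀ m (Z : List (Point (suc (2 ℕ.* m)))) → Unique Z →
  + (2 ℕ.^ suc (2 ℕ.* m)) * (+ pairSum _ Z + + central m * + length Z)
    ≤ (T (+ 2) (suc (2 ℕ.* m)) 0 e 0 + + central m) * (+ length Z * + length Z)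
spectral-bound m Z u = ℤ.*-cancelˡ-≤-pos _ _ P ⦃ 0<2^ n ⦄
  (subst₂ _≤_ (ring₁ P (+ pairSum n Z) (+ central m) (+ length Z))
              (ring₂ P (T (+ 2) n 0 e 0) (+ central m) (+ length Z))
    (pairs-eδ P (+ central m) Z u λ p q s →
      subst (_≤ P * H p q 0) (ℤ.*-comm P (+ central m))
        (ℤ.*-monoˡ-≤-nonNeg P (central≤H m p q
          (trans (ℕ.suc-injective (trans (ℕ.+-comm 1 (p ℕ.+ q)) s)) (cong (m ℕ.+_) (ℕ.+-identityʳ m)))))))
  where
  n = suc (2 ℕ.* m)
  P = + (2 ℕ.^ n)
  ring₁ : ∀ P s c N → P * (P * s + c * P * N) ≡ P * (P * (s + c * N))
  ring₁ = solve-∀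
  ring₂ : ∀ P t c N → (P * t + c * P) * (N * N) ≡ P * ((t + c) * (N * N))
  ring₂ = solve-∀

-- The kernel of ⌈w/2⌉

half : ℕ → ℤ
half w = + ⌈ w /2⌉

-- Closed under 1 + S and 1 − S; the increments of ⌈w/2⌉ give such a sequence.
Alternating : (ℕ → ℤ) → Set
Alternating u = (∀ w → u (suc (suc w)) ≡ u w) × u 0 + u 1 ≤ 0ℤ × u 0 ≤ u 1

-- By periodicity only two values matter. `1 - S` sends `(a, b)` to `(a - b, b - a)`, of sum 0 and
-- in order because `a ≤ b`; `1 + S` sends it to the constant `a + b ≤ 0`.
Alternating-T : ∀ p q {f} → Alternating f → Alternating (T 1ℤ p q f)
Alternating-T zero    zero    a = a
Alternating-T zero    (suc q) {f} a with Alternating-T zero q {f} a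
... | per , sum≤0 , u₀≤u₁ =
  (λ w → cong₂ (λ a b → 1ℤ * a + - b) (per w) (per (suc w))) ,
  ℤ.≤-reflexive (trans (cong (λ z → 1ℤ * u 0 + - u 1 + (1ℤ * u 1 + - z)) (per 0)) (ring₁ (u 0) (u 1))) ,
  subst₂ _≤_ (ring₂ (u 0) (u 1)) (trans (ring₃ (u 0) (u 1)) (cong (λ z → 1ℤ * u 1 + - z) (sym (per 0))))
    (ℤ.≤-trans (ℤ.i≤j⇒i-j≤0 u₀≤u₁) (ℤ.i≤j⇒0≤j-i u₀≤u₁))
  where
  u = T 1ℤ zero q f
  ring₁ : ∀ a b → 1ℤ * a + - b + (1ℤ * b + - a) ≡ 0ℤ
  ring₁ = solve-∀
  ring₂ : ∀ a b → a + - b ≡ 1ℤ * a + - b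
  ring₂ = solve-∀
  ring₃ : ∀ a b → b + - a ≡ 1ℤ * b + - a
  ring₃ = solve-∀
Alternating-T (suc p) q       {f} a with Alternating-T p q {f} a
... | per , sum≤0 , u₀≤u₁ =
  (λ w → cong₂ (λ a b → 1ℤ * a + b) (per w) (per (suc w))) ,
  subst (_≤ 0ℤ) (trans (ring₁ (u 0) (u 1)) (cong (λ z → 1ℤ * u 0 + u 1 + (1ℤ * u 1 + z)) (sym (per 0))))
    (ℤ.+-mono-≤ sum≤0 sum≤0) ,
  ℤ.≤-reflexive (trans (ring₂ (u 0) (u 1)) (cong (_+_ (1ℤ * u 1)) (sym (per 0))))
  where
  u = T 1ℤ p q f
  ring₁ : ∀ a b → a + b + (a + b) ≡ 1ℤ * a + b + (1ℤ * b + a)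
  ring₁ = solve-∀
  ring₂ : ∀ a b → 1ℤ * a + b ≡ 1ℤ * b + a
  ring₂ = solve-∀

-- One factor `1 - S` turns `half` into -1, 0, -1, 0, ..., which is `Alternating`; and such a
-- sequence has `2 u 0 ≤ u 0 + u 1 ≤ 0`.
T-half-minus : ∀ p q → T 1ℤ p (suc q) half 0 ≤ 0ℤ
T-half-minus p q = subst (_≤ 0ℤ) (T-minus-inner 1ℤ p q half 0) (u≤0 (Alternating-T p q
  ((λ w → ring (half w) (half (suc w))) , ℤ.neg-≤-pos {1} {0} , ℤ.neg-≤-pos {1} {0})))
  where
  ring : ∀ a b → 1ℤ * (1ℤ + a) + - 1ℤ * (1ℤ + b) ≡ 1ℤ * a + - 1ℤ * b
  ring = solve-∀
  ring′ : ∀ a → + 2 * a ≡ a + a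
  ring′ = solve-∀
  u≤0 : ∀ {u} → Alternating u → u 0 ≤ 0ℤ
  u≤0 {u} (_ , sum≤0 , u₀≤u₁) = ℤ.*-cancelˡ-≤-pos (u 0) 0ℤ (+ 2)
    (subst (_≤ 0ℤ) (sym (ring′ (u 0))) (ℤ.≤-trans (ℤ.+-monoʳ-≤ (u 0) u₀≤u₁) sum≤0))

half-sum : ∀ w → 1ℤ * half w + half (suc w) ≡ 1ℤ + + w
half-sum zero          = refl
half-sum (suc zero)    = refl
half-sum (suc (suc w)) = trans (ring (half w) (half (suc w)))
  (cong (_+_ (+ 2)) (half-sum w))
  where
  ring : ∀ a b → 1ℤ * (1ℤ + a) + (1ℤ + b) ≡ + 2 + (1ℤ * a + b)
  ring = solve-∀

-- One factor `1 + S` makes `half` the linear function `1 + w`; each further one doubles it and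
-- advances the argument by one half.
T-half-plus : ∀ k w → + 2 * T 1ℤ (suc k) 0 half w ≡ + (2 ℕ.^ k) * (+ 2 + + k + + 2 * + w)
T-half-plus zero    w = trans (cong (+ 2 *_) (half-sum w)) (ring (+ w))
  where
  ring : ∀ w → + 2 * (1ℤ + w) ≡ 1ℤ * (+ 2 + 0ℤ + + 2 * w)
  ring = solve-∀
T-half-plus (suc k) w = begin-equality
  + 2 * (1ℤ * t w + t (suc w))
    ≡⟨ ring₁ (t w) (t (suc w)) ⟩
  + 2 * t w + + 2 * t (suc w)
    ≡⟨ cong₂ _+_ (T-half-plus k w) (T-half-plus k (suc w)) ⟩
  P * (+ 2 + + k + + 2 * + w) + P * (+ 2 + + k + + 2 * (1ℤ + + w))
    ≡⟨ ring₂ P (+ k) (+ w) ⟩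
  (+ 2 * P) * (+ 2 + (1ℤ + + k) + + 2 * + w)
    ≡⟨ cong (_* (+ 2 + (1ℤ + + k) + + 2 * + w)) (ℤ.pos-* 2 (2 ℕ.^ k)) ⟨
  + (2 ℕ.^ suc k) * (+ 2 + + suc k + + 2 * + w) ∎
  where
  open ℤ.≤-Reasoning
  t = T 1ℤ (suc k) 0 half
  P = + (2 ℕ.^ k)
  ring₁ : ∀ a b → + 2 * (1ℤ * a + b) ≡ + 2 * a + + 2 * b
  ring₁ = solve-∀
  ring₂ : ∀ P k w → P * (+ 2 + k + + 2 * w) + P * (+ 2 + k + + 2 * (1ℤ + w)) ≡ (+ 2 * P) * (+ 2 + (1ℤ + k) + + 2 * w)
  ring₂ = solve-∀

-- The mean of ⌈w/2⌉ over a cube of dimension `k + 1` is `(k + 2) / 4`.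
pairs-half : ∀ k (Z : List (Point (suc k))) →
  + 4 * pairs Z half ≤ (+ 2 + + k) * (+ length Z * + length Z)
pairs-half k Z = ℤ.*-cancelˡ-≤-pos _ _ P ⦃ 0<2^ k ⦄ (begin
  P * (+ 4 * G)                            ≡⟨ ring₁ P G ⟩
  + 2 * ((+ 2 * P) * G)                    ≡⟨ cong (λ z → + 2 * (z * G)) (ℤ.pos-* 2 (2 ℕ.^ k)) ⟨
  + 2 * (+ (2 ℕ.^ suc k) * G)              ≡⟨ cong (λ z → + 2 * (+ (2 ℕ.^ suc k) * z)) (pairs-cong Z one) ⟨
  + 2 * (+ (2 ℕ.^ suc k) * pairs Z (λ w → 1ℤ ℤ.^ (suc k ∸ w) * half w))
    ≤⟨ ℤ.*-monoˡ-≤-nonNeg (+ 2) (pairs-bound 1ℤ half Z λ p q _ → T-half-minus p q) ⟩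
  + 2 * (T 1ℤ (suc k) 0 half 0 * NN)       ≡⟨ ℤ.*-assoc (+ 2) (T 1ℤ (suc k) 0 half 0) NN ⟨
  + 2 * T 1ℤ (suc k) 0 half 0 * NN         ≡⟨ cong (_* NN) (T-half-plus k 0) ⟩
  P * (+ 2 + + k + 0ℤ) * NN                ≡⟨ ring₂ P (+ k) NN ⟩
  P * ((+ 2 + + k) * NN)                   ∎)
  where
  open ℤ.≤-Reasoning
  P = + (2 ℕ.^ k)
  G = pairs Z half
  NN = + length Z * + length Z
  one : ∀ w → 1ℤ ℤ.^ (suc k ∸ w) * half w ≡ half w
  one w = trans (cong (_* half w) (ℤ.^-zeroˡ (suc k ∸ w))) (ℤ.*-identityˡ (half w))
  ring₁ : ∀ P G → P * (+ 4 * G) ≡ + 2 * ((+ 2 * P) * G)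
  ring₁ = solve-∀
  ring₂ : ∀ P k N → P * (+ 2 + k + 0ℤ) * N ≡ P * ((+ 2 + k) * N)
  ring₂ = solve-∀

-- `b` is the slack of the majorant at distance 0; distinctness counts it once per point, which
-- yields the term linear in N.
pairs-majorant : ∀ {n} (Z : List (Point n)) → Unique Z → ∀ a b c d →
  (∀ w → w ℕ.≤ n → a * + lam n w + b * δ w ≤ c * 1ℤ + d * half w) →
  a * + pairSum n Z + b * + length Z ≤ c * (+ length Z * + length Z) + d * pairs Z half
pairs-majorant {n} Z u a b c d h = subst₂ _≤_
  (trans (pairs-lin Z a b (λ w → + lam n w) δ) (cong₂ (λ x y → a * x + b * y) (pairs-lam n Z) (pairs-δ Z u)))
  (trans (pairs-lin Z c d (λ _ → 1ℤ) half) (cong (λ x → c * x + d * pairs Z half) (pairs-1 Z)))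
  (pairs-mono Z h)

-- Growth of λ

-- Written over the power of 2 that belongs to `suc w`, so that steps of λ reduce to steps of
-- `core`.
lam-suc : ∀ n w → suc w ℕ.≤ n → lam n w ≡ 2 ℕ.^ (n ∸ suc w) ℕ.* (2 ℕ.* core w)
lam-suc n w h = trans (lam≡core n w) (trans (cong (λ k → 2 ℕ.^ k ℕ.* core w) (sym (ℕ.suc-pred (n ∸ w) ⦃ ℕ.>-nonZero (ℕ.m<n⇒0<n∸m h) ⦄)))
  (trans (cong (λ k → 2 ℕ.^ suc k ℕ.* core w) (ℕ.pred[m∸n]≡m∸[1+n] n w)) (ring (2 ℕ.^ (n ∸ suc w)) (core w))))
  where
  ring : ∀ p k → 2 ℕ.* p ℕ.* k ≡ p ℕ.* (2 ℕ.* k)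
  ring = solve-∀ℕ

lam-odd-step : ∀ n i → suc (suc (2 ℕ.* i)) ℕ.≤ n → lam n (suc (suc (2 ℕ.* i))) ≡ lam n (suc (2 ℕ.* i))
lam-odd-step n i h = trans (lam≡core n _) (trans (cong (2 ℕ.^ (n ∸ suc (suc (2 ℕ.* i))) ℕ.*_) (core-odd-step i))
  (sym (lam-suc n (suc (2 ℕ.* i)) h)))

lam-even-step : ∀ n i → suc (2 ℕ.* i) ℕ.≤ n →
  lam n (suc (2 ℕ.* i)) ≡ lam n (2 ℕ.* i) ℕ.+ 2 ℕ.^ (n ∸ suc (2 ℕ.* i)) ℕ.* central i
lam-even-step n i h = trans (lam≡core n _) (trans (cong (2 ℕ.^ (n ∸ suc (2 ℕ.* i)) ℕ.*_) (core-even-step i))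
  (trans (ℕ.*-distribˡ-+ (2 ℕ.^ (n ∸ suc (2 ℕ.* i))) (2 ℕ.* core (2 ℕ.* i)) (central i))
    (cong (ℕ._+ 2 ℕ.^ (n ∸ suc (2 ℕ.* i)) ℕ.* central i) (sym (lam-suc n (2 ℕ.* i) h)))))

lam-step : ∀ n w → suc w ℕ.≤ n → lam n w ℕ.≤ lam n (suc w)
lam-step n w h with parity w
... | i , inj₁ refl = subst (lam n (2 ℕ.* i) ℕ.≤_) (sym (lam-even-step n i h)) (ℕ.m≤m+n _ _)
... | i , inj₂ refl = ℕ.≤-reflexive (sym (lam-odd-step n i h))

lam-mono : ∀ n w d → w ℕ.+ d ℕ.≤ n → lam n w ℕ.≤ lam n (w ℕ.+ d)
lam-mono n w zero    h = ℕ.≤-reflexive (cong (lam n) (sym (ℕ.+-identityʳ w)))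
lam-mono n w (suc d) h rewrite ℕ.+-suc w d =
  ℕ.≤-trans (lam-mono n w d (ℕ.≤-trans (ℕ.n≤1+n _) h)) (lam-step n (w ℕ.+ d) h)

lam≤lam-n : ∀ n w → w ℕ.≤ n → lam n w ℕ.≤ lam n n
lam≤lam-n n w h with ℕ.m≤n⇒∃[o]m+o≡n h
... | d , refl = lam-mono n w d ℕ.≤-refl

-- The route passes through `λ(2i+2) = λ(2i+1)`. This ratio is the only input to the concavity
-- argument.
lam-ratio : ∀ n i → suc (2 ℕ.* suc i) ℕ.≤ n →
  2 ℕ.* suc i ℕ.* lam n (suc (2 ℕ.* suc i)) ≡ (3 ℕ.+ 2 ℕ.* i) ℕ.* lam n (suc (2 ℕ.* i))
lam-ratio n i h = begin-equality
  2 ℕ.* suc i ℕ.* lam n (suc (2 ℕ.* suc i))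
    ≡⟨ cong (2 ℕ.* suc i ℕ.*_) (trans (lam≡core n (suc (2 ℕ.* suc i))) (cong (P ℕ.*_) (core-odd (suc i)))) ⟩
  2 ℕ.* suc i ℕ.* (P ℕ.* (suc (2 ℕ.* suc i) ℕ.* central (suc i)))
    ≡⟨ ring₁ i P (central (suc i)) ⟩
  (3 ℕ.+ 2 ℕ.* i) ℕ.* (P ℕ.* (2 ℕ.* (suc i ℕ.* central (suc i))))
    ≡⟨ cong (λ z → (3 ℕ.+ 2 ℕ.* i) ℕ.* (P ℕ.* (2 ℕ.* z))) (sym (core-even (suc i))) ⟩
  (3 ℕ.+ 2 ℕ.* i) ℕ.* (P ℕ.* (2 ℕ.* core (2 ℕ.* suc i)))
    ≡⟨ cong ((3 ℕ.+ 2 ℕ.* i) ℕ.*_) (lam-suc n (2 ℕ.* suc i) h) ⟨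
  (3 ℕ.+ 2 ℕ.* i) ℕ.* lam n (2 ℕ.* suc i)
    ≡⟨ cong (λ k → (3 ℕ.+ 2 ℕ.* i) ℕ.* lam n k) (ℕ.*-suc 2 i) ⟩
  (3 ℕ.+ 2 ℕ.* i) ℕ.* lam n (suc (suc (2 ℕ.* i)))
    ≡⟨ cong ((3 ℕ.+ 2 ℕ.* i) ℕ.*_) (lam-odd-step n i (subst (ℕ._≤ n) (ℕ.*-suc 2 i) (ℕ.≤-trans (ℕ.n≤1+n _) h))) ⟩
  (3 ℕ.+ 2 ℕ.* i) ℕ.* lam n (suc (2 ℕ.* i)) ∎
  where
  open ℕ.≤-Reasoning
  P = 2 ℕ.^ (n ∸ suc (2 ℕ.* suc i))
  ring₁ : ∀ i P k → 2 ℕ.* suc i ℕ.* (P ℕ.* (suc (2 ℕ.* suc i) ℕ.* k)) ≡ (3 ℕ.+ 2 ℕ.* i) ℕ.* (P ℕ.* (2 ℕ.* (suc i ℕ.* k)))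
  ring₁ = solve-∀ℕ

-- Chords of a concave sequence

module Chord (M : ℕ) (L : ℕ → ℕ)
  (ratio : ∀ i → suc i ℕ.≤ M → 2 ℕ.* suc i ℕ.* L (suc i) ≡ (3 ℕ.+ 2 ℕ.* i) ℕ.* L i) where

  -- Divided by `2 (j + 1)`, the right side is the line through the values at `j` and `j + 1`,
  -- because `ratio` reads `L (j + 1) = L j + L j / (2j + 2)`.
  above : ∀ d j → j ℕ.+ d ℕ.≤ M → 2 ℕ.* suc j ℕ.* L (j ℕ.+ d) ℕ.≤ (2 ℕ.+ (j ℕ.+ d) ℕ.+ j) ℕ.* L j
  above zero    j h = ℕ.≤-reflexive
    (subst (λ k → 2 ℕ.* suc j ℕ.* L k ≡ (2 ℕ.+ k ℕ.+ j) ℕ.* L j) (sym (ℕ.+-identityʳ j)) (ring j (L j)))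
    where
    ring : ∀ j l → 2 ℕ.* suc j ℕ.* l ≡ (2 ℕ.+ j ℕ.+ j) ℕ.* l
    ring = solve-∀ℕ
  above (suc d) j h rewrite ℕ.+-suc j d = ℕ.*-cancelˡ-≤ (2 ℕ.* suc i) (begin
    2 ℕ.* suc i ℕ.* (2 ℕ.* suc j ℕ.* L (suc i))             ≡⟨ ring₁ i j (L (suc i)) ⟩
    2 ℕ.* suc j ℕ.* (2 ℕ.* suc i ℕ.* L (suc i))             ≡⟨ cong (2 ℕ.* suc j ℕ.*_) (ratio i h) ⟩
    2 ℕ.* suc j ℕ.* ((3 ℕ.+ 2 ℕ.* i) ℕ.* L i)               ≡⟨ ring₂ (2 ℕ.* suc j) (3 ℕ.+ 2 ℕ.* i) (L i) ⟩
    (3 ℕ.+ 2 ℕ.* i) ℕ.* (2 ℕ.* suc j ℕ.* L i)               ≤⟨ ℕ.*-monoʳ-≤ (3 ℕ.+ 2 ℕ.* i) (above d j (ℕ.≤-trans (ℕ.n≤1+n _) h)) ⟩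
    (3 ℕ.+ 2 ℕ.* i) ℕ.* ((2 ℕ.+ i ℕ.+ j) ℕ.* L j)           ≡⟨ ring₃ d j (L j) ⟩
    -- The target coefficient exceeds `X` by exactly `d = i - j`, which is 0 at the second node of
    -- the chord.
    X ℕ.* L j                                               ≤⟨ ℕ.*-monoˡ-≤ (L j) (ℕ.m≤m+n X d) ⟩
    (X ℕ.+ d) ℕ.* L j                                       ≡⟨ ring₄ d j (L j) ⟩
    2 ℕ.* suc i ℕ.* ((2 ℕ.+ suc i ℕ.+ j) ℕ.* L j)           ∎)
    where
    open ℕ.≤-Reasoning
    i = j ℕ.+ d
    X = (3 ℕ.+ 2 ℕ.* (j ℕ.+ d)) ℕ.* (2 ℕ.+ (j ℕ.+ d) ℕ.+ j)
    ring₁ : ∀ i j l → 2 ℕ.* suc i ℕ.* (2 ℕ.* suc j ℕ.* l) ≡ 2 ℕ.* suc j ℕ.* (2 ℕ.* suc i ℕ.* l)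
    ring₁ = solve-∀ℕ
    ring₂ : ∀ a b l → a ℕ.* (b ℕ.* l) ≡ b ℕ.* (a ℕ.* l)
    ring₂ = solve-∀ℕ
    ring₃ : ∀ d j l → (3 ℕ.+ 2 ℕ.* (j ℕ.+ d)) ℕ.* ((2 ℕ.+ (j ℕ.+ d) ℕ.+ j) ℕ.* l) ≡ (3 ℕ.+ 2 ℕ.* (j ℕ.+ d)) ℕ.* (2 ℕ.+ (j ℕ.+ d) ℕ.+ j) ℕ.* l
    ring₃ = solve-∀ℕ
    ring₄ : ∀ d j l → ((3 ℕ.+ 2 ℕ.* (j ℕ.+ d)) ℕ.* (2 ℕ.+ (j ℕ.+ d) ℕ.+ j) ℕ.+ d) ℕ.* l
      ≡ 2 ℕ.* suc (j ℕ.+ d) ℕ.* ((2 ℕ.+ suc (j ℕ.+ d) ℕ.+ j) ℕ.* l)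
    ring₄ = solve-∀ℕ

  -- The same line at points up to its first node; `i + d` plays the role of `j`, and `ratio` leads
  -- down from `suc i` to `i`.
  below : ∀ d i → i ℕ.+ d ℕ.≤ M → 2 ℕ.* suc (i ℕ.+ d) ℕ.* L i ℕ.≤ (2 ℕ.+ i ℕ.+ (i ℕ.+ d)) ℕ.* L (i ℕ.+ d)
  below zero    i h = ℕ.≤-reflexive
    (subst (λ k → 2 ℕ.* suc k ℕ.* L i ≡ (2 ℕ.+ i ℕ.+ k) ℕ.* L k) (sym (ℕ.+-identityʳ i)) (ring i (L i)))
    where
    ring : ∀ j l → 2 ℕ.* suc j ℕ.* l ≡ (2 ℕ.+ j ℕ.+ j) ℕ.* l
    ring = solve-∀ℕ
  below (suc d) i h rewrite ℕ.+-suc i d = ℕ.*-cancelˡ-≤ (3 ℕ.+ 2 ℕ.* i) (begin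
    (3 ℕ.+ 2 ℕ.* i) ℕ.* (2 ℕ.* suc j ℕ.* L i)               ≡⟨ ring₂ (3 ℕ.+ 2 ℕ.* i) (2 ℕ.* suc j) (L i) ⟩
    2 ℕ.* suc j ℕ.* ((3 ℕ.+ 2 ℕ.* i) ℕ.* L i)               ≡⟨ cong (2 ℕ.* suc j ℕ.*_) (ratio i (ℕ.≤-trans (s≤s (ℕ.m≤m+n i d)) h)) ⟨
    2 ℕ.* suc j ℕ.* (2 ℕ.* suc i ℕ.* L (suc i))             ≡⟨ ring₂ (2 ℕ.* suc j) (2 ℕ.* suc i) (L (suc i)) ⟩
    2 ℕ.* suc i ℕ.* (2 ℕ.* suc j ℕ.* L (suc i))             ≤⟨ ℕ.*-monoʳ-≤ (2 ℕ.* suc i) (below d (suc i) h) ⟩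
    2 ℕ.* suc i ℕ.* ((2 ℕ.+ suc i ℕ.+ j) ℕ.* L j)           ≡⟨ ring₃ d i (L j) ⟩
    X ℕ.* L j                                               ≤⟨ ℕ.*-monoˡ-≤ (L j) (ℕ.m≤m+n X (suc d)) ⟩
    (X ℕ.+ suc d) ℕ.* L j                                   ≡⟨ ring₄ d i (L j) ⟩
    (3 ℕ.+ 2 ℕ.* i) ℕ.* ((2 ℕ.+ i ℕ.+ j) ℕ.* L j)           ∎)
    where
    open ℕ.≤-Reasoning
    j = suc (i ℕ.+ d)
    X = 2 ℕ.* suc i ℕ.* (2 ℕ.+ suc i ℕ.+ suc (i ℕ.+ d))
    ring₂ : ∀ a b l → a ℕ.* (b ℕ.* l) ≡ b ℕ.* (a ℕ.* l)
    ring₂ = solve-∀ℕ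
    ring₃ : ∀ d i l → 2 ℕ.* suc i ℕ.* ((2 ℕ.+ suc i ℕ.+ suc (i ℕ.+ d)) ℕ.* l) ≡ 2 ℕ.* suc i ℕ.* (2 ℕ.+ suc i ℕ.+ suc (i ℕ.+ d)) ℕ.* l
    ring₃ = solve-∀ℕ
    ring₄ : ∀ d i l → (2 ℕ.* suc i ℕ.* (2 ℕ.+ suc i ℕ.+ suc (i ℕ.+ d)) ℕ.+ suc d) ℕ.* l
      ≡ (3 ℕ.+ 2 ℕ.* i) ℕ.* ((2 ℕ.+ i ℕ.+ suc (i ℕ.+ d)) ℕ.* l)
    ring₄ = solve-∀ℕ

  chord : ∀ i j → i ℕ.≤ M → j ℕ.≤ M → 2 ℕ.* suc j ℕ.* L i ℕ.≤ (2 ℕ.+ i ℕ.+ j) ℕ.* L j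
  chord i j i≤M j≤M with ℕ.≤-total i j
  ... | inj₁ i≤j with ℕ.m≤n⇒∃[o]m+o≡n i≤j
  ...   | d , refl = below d i j≤M
  chord i j i≤M j≤M | inj₂ j≤i with ℕ.m≤n⇒∃[o]m+o≡n j≤i
  ...   | d , refl = above d j i≤M

  -- The line through `j` and `j + 1` again, normalised by its value at the right node.
  chord′ : ∀ i j → i ℕ.≤ M → suc j ℕ.≤ M → (3 ℕ.+ 2 ℕ.* j) ℕ.* L i ℕ.≤ (2 ℕ.+ i ℕ.+ j) ℕ.* L (suc j)
  chord′ i j i≤M j<M = ℕ.*-cancelˡ-≤ (2 ℕ.* suc j) (begin
    2 ℕ.* suc j ℕ.* ((3 ℕ.+ 2 ℕ.* j) ℕ.* L i)         ≡⟨ swap (2 ℕ.* suc j) (3 ℕ.+ 2 ℕ.* j) (L i) ⟩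
    (3 ℕ.+ 2 ℕ.* j) ℕ.* (2 ℕ.* suc j ℕ.* L i)         ≤⟨ ℕ.*-monoʳ-≤ (3 ℕ.+ 2 ℕ.* j) (chord i j i≤M (ℕ.≤-trans (ℕ.n≤1+n j) j<M)) ⟩
    (3 ℕ.+ 2 ℕ.* j) ℕ.* ((2 ℕ.+ i ℕ.+ j) ℕ.* L j)     ≡⟨ swap (3 ℕ.+ 2 ℕ.* j) (2 ℕ.+ i ℕ.+ j) (L j) ⟩
    (2 ℕ.+ i ℕ.+ j) ℕ.* ((3 ℕ.+ 2 ℕ.* j) ℕ.* L j)     ≡⟨ cong ((2 ℕ.+ i ℕ.+ j) ℕ.*_) (ratio j j<M) ⟨
    (2 ℕ.+ i ℕ.+ j) ℕ.* (2 ℕ.* suc j ℕ.* L (suc j))   ≡⟨ swap (2 ℕ.+ i ℕ.+ j) (2 ℕ.* suc j) (L (suc j)) ⟩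
    2 ℕ.* suc j ℕ.* ((2 ℕ.+ i ℕ.+ j) ℕ.* L (suc j))   ∎)
    where
    open ℕ.≤-Reasoning
    swap : ∀ a b l → a ℕ.* (b ℕ.* l) ≡ b ℕ.* (a ℕ.* l)
    swap = solve-∀ℕ

-- Diameter and chord bounds over the integers

-- The constant term of the majorant is also the weight of `δ`. At distance 0, where λ and ⌈w/2⌉
-- vanish, this gives equality, so only positive distances remain to be checked.
pairs-majorantℕ : ∀ {n} (Z : List (Point n)) → Unique Z → ∀ a b d →
  (∀ w → suc w ℕ.≤ n → a ℕ.* lam n (suc w) ℕ.≤ b ℕ.+ d ℕ.* ⌈ suc w /2⌉) →
  + a * + pairSum n Z + + b * + length Z ≤ + b * (+ length Z * + length Z) + + d * pairs Z half
pairs-majorantℕ {n} Z u a b d h = pairs-majorant Z u (+ a) (+ b) (+ b) (+ d) λ where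
    zero    _ → ℤ.≤-reflexive (ring₀ (+ a) (+ b) (+ d))
    (suc w) p → subst₂ _≤_
      (trans (ℤ.pos-* a (lam n (suc w))) (ring₁ (+ a * + lam n (suc w)) (+ b)))
      (cong₂ _+_ (sym (ℤ.*-identityʳ (+ b))) (ℤ.pos-* d ⌈ suc w /2⌉))
      (+≤+ (h w p))
  where
  ring₀ : ∀ a b d → a * 0ℤ + b * 1ℤ ≡ b * 1ℤ + d * 0ℤ
  ring₀ = solve-∀
  ring₁ : ∀ x b → x ≡ x + b * 0ℤ
  ring₁ = solve-∀

diameter-bound : ∀ n (Z : List (Point n)) → Unique Z →
  + pairSum n Z + + lam n n * + length Z ≤ + lam n n * (+ length Z * + length Z)
diameter-bound n Z u = subst₂ _≤_
  (cong (_+ + lam n n * + length Z) (ℤ.*-identityˡ (+ pairSum n Z)))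
  (ℤ.+-identityʳ (+ lam n n * (+ length Z * + length Z)))
  (pairs-majorantℕ Z u 1 (lam n n) 0 λ w p →
    subst₂ ℕ._≤_ (sym (ℕ.*-identityˡ (lam n (suc w)))) (sym (ℕ.+-identityʳ (lam n n))) (lam≤lam-n n (suc w) p))

-- The majorant of `2 (M + 1) λ` is `ℓ (s + 2 ⌈w/2⌉)`. Odd distances `2i + 1` suffice, since
-- `2i + 2` has the same λ and the same ⌈w/2⌉.
chord-bound : ∀ M (Z : List (Point (suc (2 ℕ.* M)))) → Unique Z → ∀ ℓ s →
  (∀ i → i ℕ.≤ M → 2 ℕ.* suc M ℕ.* lam (suc (2 ℕ.* M)) (suc (2 ℕ.* i)) ℕ.≤ ℓ ℕ.* s ℕ.+ 2 ℕ.* ℓ ℕ.* suc i) →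
  + 2 * + suc M * + pairSum _ Z + + ℓ * + s * + length Z ≤ + ℓ * (+ s + + suc M) * (+ length Z * + length Z)
-- Doubling produces the factor 4 in front of `G` that `pairs-half` controls.
chord-bound M Z u ℓ s h = ℤ.*-cancelˡ-≤-pos _ _ (+ 2) (begin
  + 2 * (+ 2 * + suc M * PS + + ℓ * + s * N)
    ≡⟨ cong (+ 2 *_) (cong₂ (λ x y → x * PS + y * N) (sym (ℤ.pos-* 2 (suc M))) (sym (ℤ.pos-* ℓ s))) ⟩
  + 2 * (+ (2 ℕ.* suc M) * PS + + (ℓ ℕ.* s) * N)
    ≤⟨ ℤ.*-monoˡ-≤-nonNeg (+ 2) (pairs-majorantℕ Z u (2 ℕ.* suc M) (ℓ ℕ.* s) (2 ℕ.* ℓ) pointwise) ⟩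
  + 2 * (+ (ℓ ℕ.* s) * (N * N) + + (2 ℕ.* ℓ) * G)
    ≡⟨ cong (+ 2 *_) (cong₂ (λ x y → x * (N * N) + y * G) (ℤ.pos-* ℓ s) (ℤ.pos-* 2 ℓ)) ⟩
  + 2 * (+ ℓ * + s * (N * N) + + 2 * + ℓ * G)
    ≡⟨ ring₁ (+ ℓ) (+ s) N G ⟩
  + 2 * (+ ℓ * + s * (N * N)) + + ℓ * (+ 4 * G)
    ≤⟨ ℤ.+-monoʳ-≤ (+ 2 * (+ ℓ * + s * (N * N))) (ℤ.*-monoˡ-≤-nonNeg (+ ℓ) (pairs-half (2 ℕ.* M) Z)) ⟩
  + 2 * (+ ℓ * + s * (N * N)) + + ℓ * ((+ 2 + + (2 ℕ.* M)) * (N * N))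
    ≡⟨ cong (λ z → + 2 * (+ ℓ * + s * (N * N)) + + ℓ * ((+ 2 + z) * (N * N))) (ℤ.pos-* 2 M) ⟩
  + 2 * (+ ℓ * + s * (N * N)) + + ℓ * ((+ 2 + + 2 * + M) * (N * N))
    ≡⟨ ring₂ (+ ℓ) (+ s) (+ M) N ⟩
  + 2 * (+ ℓ * (+ s + (1ℤ + + M)) * (N * N)) ∎)
  where
  open ℤ.≤-Reasoning
  n = suc (2 ℕ.* M)
  PS = + pairSum n Z
  N = + length Z
  G = pairs Z half
  ring₁ : ∀ ℓ s N G → + 2 * (ℓ * s * (N * N) + + 2 * ℓ * G) ≡ + 2 * (ℓ * s * (N * N)) + ℓ * (+ 4 * G)
  ring₁ = solve-∀
  ring₂ : ∀ ℓ s M N → + 2 * (ℓ * s * (N * N)) + ℓ * ((+ 2 + + 2 * M) * (N * N)) ≡ + 2 * (ℓ * (s + (1ℤ + M)) * (N * N))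
  ring₂ = solve-∀
  pointwise : ∀ w → suc w ℕ.≤ n → 2 ℕ.* suc M ℕ.* lam n (suc w) ℕ.≤ ℓ ℕ.* s ℕ.+ 2 ℕ.* ℓ ℕ.* ⌈ suc w /2⌉
  pointwise w p with parity w
  ... | i , inj₁ refl = subst (λ k → 2 ℕ.* suc M ℕ.* lam n (suc (2 ℕ.* i)) ℕ.≤ ℓ ℕ.* s ℕ.+ 2 ℕ.* ℓ ℕ.* suc k)
    (sym (⌊2i/2⌋ i)) (h i (ℕ.*-cancelˡ-≤ 2 (ℕ.s≤s⁻¹ p)))
  ... | i , inj₂ refl = subst₂ (λ l k → 2 ℕ.* suc M ℕ.* l ℕ.≤ ℓ ℕ.* s ℕ.+ 2 ℕ.* ℓ ℕ.* suc k)
    (sym (lam-odd-step n i p)) (sym (⌊1+2i/2⌋ i)) (h i (ℕ.*-cancelˡ-≤ 2 (ℕ.≤-trans (ℕ.n≤1+n _) (ℕ.s≤s⁻¹ p))))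

module _ (M : ℕ) where
  open Chord M (λ i → lam (suc (2 ℕ.* M)) (suc (2 ℕ.* i)))
    (λ i i<M → lam-ratio (suc (2 ℕ.* M)) i (s≤s (ℕ.*-monoʳ-≤ 2 i<M))) public

-- Here `t = M + 1 = 2J + 2` and ⌈w/2⌉ has mean `J + 1`. The chord through indices `J` and `J + 1`
-- takes the value `λ(2J+1) = λ(t)` at this mean, and half of it at distance 0.
even-bound : ∀ J → let M = suc (2 ℕ.* J) ; n = suc (2 ℕ.* M) in (Z : List (Point n)) → Unique Z →
  + 2 * + pairSum n Z + + lam n (suc M) * + length Z ≤ + 2 * + lam n (suc M) * (+ length Z * + length Z)
even-bound J Z u = ℤ.*-cancelˡ-≤-pos _ _ (+ suc M)
  (subst₂ _≤_ (ring₁ (+ suc M) (+ pairSum n Z) (+ ℓ) (+ length Z)) (ring₂ (+ suc M) (+ ℓ) (+ length Z))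
    (chord-bound M Z u ℓ (suc M) bound))
  where
  M = suc (2 ℕ.* J)
  n = suc (2 ℕ.* M)
  ℓ = lam n (suc M)
  J≤M : J ℕ.≤ M
  J≤M = ℕ.≤-trans (ℕ.m≤m+n J (J ℕ.+ 0)) (ℕ.n≤1+n _)
  ℓ≡ : ℓ ≡ lam n (suc (2 ℕ.* J))
  ℓ≡ = lam-odd-step n J (s≤s (ℕ.m≤m+n M (M ℕ.+ 0)))
  ring₁ : ∀ t p l N → + 2 * t * p + l * t * N ≡ t * (+ 2 * p + l * N)
  ring₁ = solve-∀
  ring₂ : ∀ t l N → l * (t + t) * (N * N) ≡ t * (+ 2 * l * (N * N))
  ring₂ = solve-∀
  ring₃ : ∀ J x → 2 ℕ.* suc (suc (2 ℕ.* J)) ℕ.* x ≡ 2 ℕ.* (2 ℕ.* suc J ℕ.* x)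
  ring₃ = solve-∀ℕ
  ring₄ : ∀ i J l → 2 ℕ.* ((2 ℕ.+ i ℕ.+ J) ℕ.* l) ≡ l ℕ.* suc (suc (2 ℕ.* J)) ℕ.+ 2 ℕ.* l ℕ.* suc i
  ring₄ = solve-∀ℕ
  bound : ∀ i → i ℕ.≤ M → 2 ℕ.* suc M ℕ.* lam n (suc (2 ℕ.* i)) ℕ.≤ ℓ ℕ.* suc M ℕ.+ 2 ℕ.* ℓ ℕ.* suc i
  bound i i≤M = subst₂ ℕ._≤_ (sym (ring₃ J (lam n (suc (2 ℕ.* i)))))
    (trans (ring₄ i J (lam n (suc (2 ℕ.* J)))) (cong (λ l → l ℕ.* suc M ℕ.+ 2 ℕ.* l ℕ.* suc i) (sym ℓ≡)))
    (ℕ.*-monoʳ-≤ 2 (chord M i J i≤M J≤M))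

-- Here `t = M + 1 = 2J + 1` and ⌈w/2⌉ has mean `J + 1/2`, midway between the nodes of the chord
-- through indices `J - 1` and `J`; the right node carries the value `λ(t)`.
odd-bound : ∀ J → let M = 2 ℕ.* J ; n = suc (2 ℕ.* M) in (Z : List (Point n)) → Unique Z →
  + 2 * + suc M * + pairSum n Z + + lam n (suc M) * + M * + length Z
    ≤ + lam n (suc M) * (+ M + + suc M) * (+ length Z * + length Z)
odd-bound J Z u = chord-bound (2 ℕ.* J) Z u (lam n (suc (2 ℕ.* J))) (2 ℕ.* J) (bound J)
  where
  n = suc (2 ℕ.* (2 ℕ.* J))
  bound : ∀ J i → let M = 2 ℕ.* J ; n = suc (2 ℕ.* M) in i ℕ.≤ M →
    2 ℕ.* suc M ℕ.* lam n (suc (2 ℕ.* i)) ℕ.≤ lam n (suc M) ℕ.* M ℕ.+ 2 ℕ.* lam n (suc M) ℕ.* suc i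
  -- For `n = 1` there is no index `J - 1`; the only positive distance is 1, and there equality
  -- holds.
  bound zero    zero    _   = ℕ.≤-refl
  bound (suc J) i       i≤M = subst₂ ℕ._≤_ (ring₁ J (lam n′ (suc (2 ℕ.* i)))) (ring₂ i J (lam n′ (suc (2 ℕ.* suc J))))
    (ℕ.*-monoʳ-≤ 2 (chord′ (2 ℕ.* suc J) i J i≤M (ℕ.m≤m+n (suc J) (suc J ℕ.+ 0))))
    where
    n′ = suc (2 ℕ.* (2 ℕ.* suc J))
    ring₁ : ∀ J x → 2 ℕ.* ((3 ℕ.+ 2 ℕ.* J) ℕ.* x) ≡ 2 ℕ.* suc (2 ℕ.* suc J) ℕ.* x
    ring₁ = solve-∀ℕ
    ring₂ : ∀ i J l → 2 ℕ.* ((2 ℕ.+ i ℕ.+ J) ℕ.* l) ≡ l ℕ.* (2 ℕ.* suc J) ℕ.+ 2 ℕ.* l ℕ.* suc i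
    ring₂ = solve-∀ℕ

-- Krawtchouk values at the midpoint

∑< : ℕ → (ℕ → ℤ) → ℤ
∑< zero    f = 0ℤ
∑< (suc n) f = f 0 + ∑< n (λ i → f (suc i))

foldr-applyUpTo : ∀ (f : ℕ → ℤ) g n → foldr _+_ 0ℤ (map f (applyUpTo g n)) ≡ ∑< n (λ i → f (g i))
foldr-applyUpTo f g zero    = refl
foldr-applyUpTo f g (suc n) = cong (_+_ (f (g 0))) (foldr-applyUpTo f (λ i → g (suc i)) n)

∑<-cong : ∀ n {f g} → (∀ i → i ℕ.< n → f i ≡ g i) → ∑< n f ≡ ∑< n g
∑<-cong zero    h = refl
∑<-cong (suc n) h = cong₂ _+_ (h 0 (s≤s z≤n)) (∑<-cong n λ i i<n → h (suc i) (s≤s i<n))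

∑<-lin : ∀ n ε f g → ∑< n (λ i → f i + ε * g i) ≡ ∑< n f + ε * ∑< n g
∑<-lin zero    ε f g = sym (trans (ℤ.+-identityˡ (ε * 0ℤ)) (ℤ.*-zeroʳ ε))
∑<-lin (suc n) ε f g = trans
  (cong (_+_ (f 0 + ε * g 0)) (∑<-lin n ε (λ i → f (suc i)) (λ i → g (suc i))))
  (ring ε (f 0) (g 0) (∑< n (λ i → f (suc i))) (∑< n (λ i → g (suc i))))
  where
  ring : ∀ ε a b x y → (a + ε * b) + (x + ε * y) ≡ (a + x) + ε * (b + y)
  ring = solve-∀

∑<-zero : ∀ n {f} → (∀ i → f i ≡ 0ℤ) → ∑< n f ≡ 0ℤ
∑<-zero zero    h = refl
∑<-zero (suc n) h = cong₂ _+_ (h 0) (∑<-zero n λ i → h (suc i))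

∑<-evens : ∀ m g → (∀ i → g (suc (2 ℕ.* i)) ≡ 0ℤ) → ∑< (suc (2 ℕ.* m)) g ≡ ∑< (suc m) (λ i → g (2 ℕ.* i))
∑<-evens zero    g h = refl
∑<-evens (suc m) g h = begin-equality
  ∑< (suc (2 ℕ.* suc m)) g                                          ≡⟨ cong (λ k → ∑< (suc k) g) (ℕ.*-suc 2 m) ⟩
  g 0 + (g 1 + ∑< (suc (2 ℕ.* m)) (λ i → g (suc (suc i))))          ≡⟨ cong₂ (λ a b → g 0 + (a + b)) (h 0)
      (∑<-evens m (λ i → g (suc (suc i))) λ i → trans (cong (λ k → g (suc k)) (sym (ℕ.*-suc 2 i))) (h (suc i))) ⟩
  g 0 + (0ℤ + ∑< (suc m) (λ i → g (suc (suc (2 ℕ.* i)))))           ≡⟨ cong (_+_ (g 0)) (trans (ℤ.+-identityˡ _)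
      (∑<-cong (suc m) λ i _ → cong g (sym (ℕ.*-suc 2 i)))) ⟩
  g 0 + ∑< (suc m) (λ i → g (2 ℕ.* suc i))                          ∎
  where open ℤ.≤-Reasoning

conv : (ℕ → ℤ) → (ℕ → ℤ) → ℕ → ℤ
conv F G s = ∑< (suc s) (λ i → F i * G (s ∸ i))

-- In generating functions: multiplying the first factor by `1 + ε z` multiplies the product by it.
-- `ε = 1` serves Vandermonde, `ε = -1` the signed rows.
conv-step : ∀ ε F F′ G → F′ 0 ≡ F 0 → (∀ i → F′ (suc i) ≡ F (suc i) + ε * F i) →
  ∀ s → conv F′ G (suc s) ≡ conv F G (suc s) + ε * conv F G s
conv-step ε F F′ G h₀ h s = begin-equality
  F′ 0 * G (suc s) + ∑< (suc s) (λ i → F′ (suc i) * G (s ∸ i))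
    ≡⟨ cong₂ _+_ (cong (_* G (suc s)) h₀) (∑<-cong (suc s) λ i _ →
         trans (cong (_* G (s ∸ i)) (h i)) (ring₁ (F (suc i)) ε (F i) (G (s ∸ i)))) ⟩
  F 0 * G (suc s) + ∑< (suc s) (λ i → F (suc i) * G (s ∸ i) + ε * (F i * G (s ∸ i)))
    ≡⟨ cong (_+_ (F 0 * G (suc s))) (∑<-lin (suc s) ε (λ i → F (suc i) * G (s ∸ i)) (λ i → F i * G (s ∸ i))) ⟩
  F 0 * G (suc s) + (∑< (suc s) (λ i → F (suc i) * G (s ∸ i)) + ε * conv F G s)
    ≡⟨ ℤ.+-assoc (F 0 * G (suc s)) (∑< (suc s) (λ i → F (suc i) * G (s ∸ i))) (ε * conv F G s) ⟨
  conv F G (suc s) + ε * conv F G s ∎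
  where
  open ℤ.≤-Reasoning
  ring₁ : ∀ a ε b g → (a + ε * b) * g ≡ a * g + ε * (b * g)
  ring₁ = solve-∀

conv-unit : ∀ F G → F 0 ≡ 1ℤ → (∀ i → F (suc i) ≡ 0ℤ) → ∀ s → conv F G s ≡ G s
conv-unit F G h₀ h s = trans
  (cong₂ _+_ (trans (cong (_* G s) h₀) (ℤ.*-identityˡ (G s))) (∑<-zero s λ i → cong (_* G (s ∸ suc i)) (h i)))
  (ℤ.+-identityʳ (G s))

bin : ℕ → ℕ → ℤ
bin q i = + (q C i)

bin-0 : ∀ i → bin 0 (suc i) ≡ 0ℤ
bin-0 i = cong +_ (k>n⇒nCk≡0 {0} {suc i} (s≤s z≤n))

pascal : ∀ q i → bin (suc q) (suc i) ≡ bin q (suc i) + bin q i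
pascal q i = cong +_ (trans (sym (nCk+nC[k+1]≡[n+1]C[k+1] q i)) (ℕ.+-comm (q C i) (q C suc i)))

vandermonde : ∀ p q s → conv (bin q) (bin p) s ≡ bin (q ℕ.+ p) s
vandermonde p zero    s       = conv-unit (bin 0) (bin p) refl bin-0 s
vandermonde p (suc q) zero    = refl
vandermonde p (suc q) (suc s) = begin-equality
  conv (bin (suc q)) (bin p) (suc s)
    ≡⟨ conv-step 1ℤ (bin q) (bin (suc q)) (bin p) refl
         (λ i → trans (pascal q i) (cong (_+_ (bin q (suc i))) (sym (ℤ.*-identityˡ (bin q i))))) s ⟩
  conv (bin q) (bin p) (suc s) + 1ℤ * conv (bin q) (bin p) s
    ≡⟨ cong₂ (λ a b → a + b) (vandermonde p q (suc s)) (trans (ℤ.*-identityˡ _) (vandermonde p q s)) ⟩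
  bin (q ℕ.+ p) (suc s) + bin (q ℕ.+ p) s
    ≡⟨ pascal (q ℕ.+ p) s ⟨
  bin (suc q ℕ.+ p) (suc s) ∎
  where open ℤ.≤-Reasoning

sbin : ℕ → ℕ → ℤ
sbin q i = sgn i * bin q i

sbin-step : ∀ q i → sbin (suc q) (suc i) ≡ sbin q (suc i) + - 1ℤ * sbin q i
sbin-step q i = trans (cong (- sgn i *_) (pascal q i)) (ring (sgn i) (bin q (suc i)) (bin q i))
  where
  ring : ∀ s a b → - s * (a + b) ≡ - s * a + - 1ℤ * (s * b)
  ring = solve-∀

-- The coefficient of z^s in (1 - z)^q (1 + z)^p.
coeff : ℕ → ℕ → ℕ → ℤ
coeff p q = conv (sbin q) (bin p)

coeff-sucʳ : ∀ p q s → coeff p (suc q) (suc s) ≡ coeff p q (suc s) + - 1ℤ * coeff p q s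
coeff-sucʳ p q = conv-step (- 1ℤ) (sbin q) (sbin (suc q)) (bin p) refl (sbin-step q)

coeff-0 : ∀ p s → coeff p 0 s ≡ bin p s
coeff-0 p = conv-unit (sbin 0) (bin p) refl λ i → trans (cong (- sgn i *_) (bin-0 i)) (ℤ.*-zeroʳ (- sgn i))

-- The new factor `1 + z` belongs to the second argument of `conv`, out of reach of `conv-step`;
-- induction on `q` peels off the factors `1 - z` until a plain binomial row remains.
coeff-sucˡ : ∀ p q s → coeff (suc p) q (suc s) ≡ coeff p q (suc s) + coeff p q s
coeff-sucˡ p zero    s = trans (coeff-0 (suc p) (suc s))
  (trans (pascal p s) (sym (cong₂ _+_ (coeff-0 p (suc s)) (coeff-0 p s))))
-- Coefficient 1 is treated apart: the index drops to 0, where every `coeff` is 1 and `coeff-sucʳ`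
-- no longer applies.
coeff-sucˡ p (suc q) zero = trans (coeff-sucʳ (suc p) q 0) (trans (cong (_+ - 1ℤ * coeff (suc p) q 0) (coeff-sucˡ p q 0))
  (trans (ring (coeff p q 1)) (cong (_+ 1ℤ) (sym (coeff-sucʳ p q 0)))))
  where
  ring : ∀ a → a + 1ℤ + - 1ℤ * 1ℤ ≡ a + - 1ℤ * 1ℤ + 1ℤ
  ring = solve-∀
coeff-sucˡ p (suc q) (suc s) = trans (coeff-sucʳ (suc p) q (suc s))
  (trans (cong₂ (λ a b → a + - 1ℤ * b) (coeff-sucˡ p q (suc s)) (coeff-sucˡ p q s))
  (trans (ring (coeff p q (suc (suc s))) (coeff p q (suc s)) (coeff p q s))
         (sym (cong₂ _+_ (coeff-sucʳ p q (suc s)) (coeff-sucʳ p q s)))))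
  where
  ring : ∀ a b c → (a + b) + - 1ℤ * (b + c) ≡ (a + - 1ℤ * b) + (b + - 1ℤ * c)
  ring = solve-∀

-- Multiplication by `(1 - z)(1 + z) = 1 - z^2`; hence the diagonal coefficients are those of
-- `(1 - z^2)^m`.
coeff-diag : ∀ m s → coeff (suc m) (suc m) (suc (suc s)) ≡ coeff m m (suc (suc s)) + - 1ℤ * coeff m m s
coeff-diag m s = trans (coeff-sucʳ (suc m) m (suc s))
  (trans (cong₂ (λ a b → a + - 1ℤ * b) (coeff-sucˡ m m (suc s)) (coeff-sucˡ m m s))
         (ring (coeff m m (suc (suc s))) (coeff m m (suc s)) (coeff m m s)))
  where
  ring : ∀ a b c → (a + b) + - 1ℤ * (b + c) ≡ a + - 1ℤ * c
  ring = solve-∀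

coeff-odd : ∀ m i → coeff m m (suc (2 ℕ.* i)) ≡ 0ℤ
coeff-odd zero    i       = trans (coeff-0 0 (suc (2 ℕ.* i))) (bin-0 (2 ℕ.* i))
coeff-odd (suc m) zero    = trans (coeff-sucʳ (suc m) m 0)
  (trans (cong (_+ - 1ℤ * 1ℤ) (coeff-sucˡ m m 0)) (cong (λ z → z + 1ℤ + - 1ℤ * 1ℤ) (coeff-odd m 0)))
coeff-odd (suc m) (suc i) = begin-equality
  coeff (suc m) (suc m) (suc (2 ℕ.* suc i))                     ≡⟨ cong (λ k → coeff (suc m) (suc m) (suc k)) (ℕ.*-suc 2 i) ⟩
  coeff (suc m) (suc m) (suc (suc (suc (2 ℕ.* i))))             ≡⟨ coeff-diag m (suc (2 ℕ.* i)) ⟩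
  coeff m m (suc (suc (suc (2 ℕ.* i)))) + - 1ℤ * coeff m m (suc (2 ℕ.* i))
    ≡⟨ cong₂ (λ a b → a + - 1ℤ * b) (trans (cong (λ k → coeff m m (suc k)) (sym (ℕ.*-suc 2 i))) (coeff-odd m (suc i))) (coeff-odd m i) ⟩
  0ℤ ∎
  where open ℤ.≤-Reasoning

coeff-even : ∀ m i → coeff m m (2 ℕ.* i) ≡ sbin m i
coeff-even m       zero    = refl
coeff-even zero    (suc i) = trans (coeff-0 0 (2 ℕ.* suc i)) (trans (bin-0 (i ℕ.+ suc (i ℕ.+ 0)))
  (sym (trans (cong (- sgn i *_) (bin-0 i)) (ℤ.*-zeroʳ (- sgn i)))))
coeff-even (suc m) (suc i) = begin-equality
  coeff (suc m) (suc m) (2 ℕ.* suc i)                     ≡⟨ cong (coeff (suc m) (suc m)) (ℕ.*-suc 2 i) ⟩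
  coeff (suc m) (suc m) (suc (suc (2 ℕ.* i)))             ≡⟨ coeff-diag m (2 ℕ.* i) ⟩
  coeff m m (suc (suc (2 ℕ.* i))) + - 1ℤ * coeff m m (2 ℕ.* i)
    ≡⟨ cong₂ (λ a b → a + - 1ℤ * b) (trans (cong (coeff m m) (sym (ℕ.*-suc 2 i))) (coeff-even m (suc i))) (coeff-even m i) ⟩
  sbin m (suc i) + - 1ℤ * sbin m i                        ≡⟨ sbin-step m i ⟨
  sbin (suc m) (suc i)                                    ∎
  where open ℤ.≤-Reasoning

sgn² : ∀ i → sgn i * sgn i ≡ 1ℤ
sgn² zero    = refl
sgn² (suc i) = trans (ring (sgn i)) (sgn² i)
  where
  ring : ∀ s → - s * - s ≡ s * s
  ring = solve-∀

kraw-midpoint : ∀ m s → kraw (2 ℕ.* m) s m ≡ coeff m m s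
kraw-midpoint m s = trans (foldr-applyUpTo (λ i → sgn i * + ((m C i) ℕ.* ((2 ℕ.* m ∸ m) C (s ∸ i)))) id (suc s)) (∑<-cong (suc s) λ i _ →
  trans (cong (λ k → sgn i * + ((m C i) ℕ.* (k C (s ∸ i)))) (trans (ℕ.m+n∸m≡n m (m ℕ.+ 0)) (ℕ.+-identityʳ m)))
  (trans (cong (sgn i *_) (ℤ.pos-* (m C i) (m C (s ∸ i)))) (sym (ℤ.*-assoc (sgn i) (bin m i) (bin m (s ∸ i))))))

-- The values are `C(m,i)` up to sign at `s = 2i` and 0 at odd `s`. Reflecting `i` to `m - i` in one
-- factor of each square gives a Vandermonde sum.
kraw-square-sum : ∀ m →
  foldr _+_ 0ℤ (map (λ s → kraw (2 ℕ.* m) s m * kraw (2 ℕ.* m) s m) (upTo (suc (2 ℕ.* m)))) ≡ + central m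
kraw-square-sum m = begin-equality
  foldr _+_ 0ℤ (map (λ s → kraw (2 ℕ.* m) s m * kraw (2 ℕ.* m) s m) (upTo (suc (2 ℕ.* m))))
    ≡⟨ foldr-applyUpTo (λ s → kraw (2 ℕ.* m) s m * kraw (2 ℕ.* m) s m) id (suc (2 ℕ.* m)) ⟩
  ∑< (suc (2 ℕ.* m)) (λ s → kraw (2 ℕ.* m) s m * kraw (2 ℕ.* m) s m)
    ≡⟨ ∑<-cong (suc (2 ℕ.* m)) (λ s _ → cong₂ _*_ (kraw-midpoint m s) (kraw-midpoint m s)) ⟩
  ∑< (suc (2 ℕ.* m)) (λ s → coeff m m s * coeff m m s)
    ≡⟨ ∑<-evens m (λ s → coeff m m s * coeff m m s) (λ i → cong₂ _*_ (coeff-odd m i) (coeff-odd m i)) ⟩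
  ∑< (suc m) (λ i → coeff m m (2 ℕ.* i) * coeff m m (2 ℕ.* i))
    ≡⟨ ∑<-cong (suc m) (λ i i≤m → trans (cong₂ _*_ (coeff-even m i) (coeff-even m i)) (trans (ring (sgn i) (bin m i))
         (trans (cong (_* (bin m i * bin m i)) (sgn² i)) (trans (ℤ.*-identityˡ (bin m i * bin m i))
           (cong (λ k → bin m i * + k) (nCk≡nC[n∸k] (ℕ.s≤s⁻¹ i≤m))))))) ⟩
  conv (bin m) (bin m) m
    ≡⟨ vandermonde m m m ⟩
  bin (m ℕ.+ m) m
    ≡⟨ cong (λ k → bin (m ℕ.+ k) m) (ℕ.+-identityʳ m) ⟨
  + central m ∎
  where
  open ℤ.≤-Reasoning
  ring : ∀ s b → (s * b) * (s * b) ≡ (s * s) * (b * b)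
  ring = solve-∀

-- Passage to rationals

ιℤ : ℤ → ℚ
ιℤ z = z ℚ./ 1

toℚᵘ-ιℤ : ∀ z → toℚᵘ (ιℤ z) ≃ mkℚᵘ z 0
toℚᵘ-ιℤ z = ℚ.toℚᵘ-fromℚᵘ (mkℚᵘ z 0)

ιℤ-+ : ∀ a b → ιℤ (a + b) ≡ ιℤ a ℚ.+ ιℤ b
ιℤ-+ a b = ℚ.toℚᵘ-injective (begin
  toℚᵘ (ιℤ (a + b))                  ≈⟨ toℚᵘ-ιℤ (a + b) ⟩
  mkℚᵘ (a + b) 0                     ≈⟨ *≡* (ring a b) ⟩
  mkℚᵘ a 0 ℚᵘ.+ mkℚᵘ b 0             ≈⟨ ℚᵘ.+-cong (toℚᵘ-ιℤ a) (toℚᵘ-ιℤ b) ⟨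
  toℚᵘ (ιℤ a) ℚᵘ.+ toℚᵘ (ιℤ b)       ≈⟨ ℚ.toℚᵘ-homo-+ (ιℤ a) (ιℤ b) ⟨
  toℚᵘ (ιℤ a ℚ.+ ιℤ b)               ∎)
  where
  open ℚᵘ.≃-Reasoning
  ring : ∀ a b → (a + b) * 1ℤ ≡ (a * 1ℤ + b * 1ℤ) * 1ℤ
  ring = solve-∀

ιℤ-* : ∀ a b → ιℤ (a * b) ≡ ιℤ a ℚ.* ιℤ b
ιℤ-* a b = ℚ.toℚᵘ-injective (begin
  toℚᵘ (ιℤ (a * b))                  ≈⟨ toℚᵘ-ιℤ (a * b) ⟩
  mkℚᵘ (a * b) 0                     ≈⟨ ℚᵘ.*-cong (toℚᵘ-ιℤ a) (toℚᵘ-ιℤ b) ⟨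
  toℚᵘ (ιℤ a) ℚᵘ.* toℚᵘ (ιℤ b)       ≈⟨ ℚ.toℚᵘ-homo-* (ιℤ a) (ιℤ b) ⟨
  toℚᵘ (ιℤ a ℚ.* ιℤ b)               ∎)
  where open ℚᵘ.≃-Reasoning

ιℤ-mono : ∀ {a b} → a ≤ b → ιℤ a ℚ.≤ ιℤ b
ιℤ-mono {a} {b} h = ℚ.toℚᵘ-cancel-≤ (ℚᵘ.≤-respˡ-≃ (ℚᵘ.≃-sym (toℚᵘ-ιℤ a)) (ℚᵘ.≤-respʳ-≃ (ℚᵘ.≃-sym (toℚᵘ-ιℤ b))
  (*≤* (ℤ.*-monoʳ-≤-nonNeg 1ℤ h))))

ι-* : ∀ a b → ι (a ℕ.* b) ≡ ι a ℚ.* ι b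
ι-* a b = trans (cong ιℤ (ℤ.pos-* a b)) (ιℤ-* (+ a) (+ b))

ι-suc*/ : ∀ a k → ι (suc k) ℚ.* (+ a ℚ./ suc k) ≡ ι a
ι-suc*/ a k = ℚ.toℚᵘ-injective (begin
  toℚᵘ (ι (suc k) ℚ.* (+ a ℚ./ suc k))           ≈⟨ ℚ.toℚᵘ-homo-* (ι (suc k)) (+ a ℚ./ suc k) ⟩
  toℚᵘ (ι (suc k)) ℚᵘ.* toℚᵘ (+ a ℚ./ suc k)     ≈⟨ ℚᵘ.*-cong (toℚᵘ-ιℤ (+ suc k)) (ℚ.toℚᵘ-fromℚᵘ (mkℚᵘ (+ a) k)) ⟩
  mkℚᵘ (+ suc k) 0 ℚᵘ.* mkℚᵘ (+ a) k             ≈⟨ *≡* (trans (ring (+ suc k) (+ a)) (cong (λ d → + a * (+ suc d)) (sym (ℕ.+-identityʳ k)))) ⟩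
  mkℚᵘ (+ a) 0                                   ≈⟨ toℚᵘ-ιℤ (+ a) ⟨
  toℚᵘ (ι a)                                     ∎)
  where
  open ℚᵘ.≃-Reasoning
  ring : ∀ k a → k * a * 1ℤ ≡ a * k
  ring = solve-∀

inv2^-inverse : ∀ n → ι (2 ℕ.^ n) ℚ.* inv2^ n ≡ 1ℚ
inv2^-inverse zero    = refl
inv2^-inverse (suc n) = trans (cong (ℚ._* (½ ℚ.* inv2^ n)) (ι-* 2 (2 ℕ.^ n)))
  (trans (solve 2 (λ p u → (con (ι 2) :* p) :* (con ½ :* u) := p :* u) refl (ι (2 ℕ.^ n)) (inv2^ n)) (inv2^-inverse n))

-- `D` clears the denominators of `X`, and `y` holds the subtracted part of the bound, so that the
-- integer hypothesis needs no subtraction; the last premise identifies `z` with the scaled bound.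
Eλ≤ : ∀ n (Z : List (Point n)) → 1 ℕ.≤ length Z → ∀ D .⦃ _ : ℕ.NonZero D ⦄ X y z →
  + D * + pairSum n Z + y ≤ z →
  ι D ℚ.* (ι (length Z) ℚ.* X) ℚ.+ ιℤ y ≡ ιℤ z →
  Eλ n Z ℚ.≤ X
Eλ≤ n Z@(_ ∷ zs) _ D X y z h eq =
  ℚ.*-cancelˡ-≤-pos (ι N) ⦃ ℚ.normalize-pos N 1 ⦄
    (ℚ.*-cancelˡ-≤-pos (ι D) ⦃ ℚ.normalize-pos D 1 ⦄
      (subst₂ ℚ._≤_ (cancel _ (ιℤ y)) (cancel _ (ιℤ y)) (ℚ.+-monoˡ-≤ (ℚ.- ιℤ y) bound)))
  where
  N = length Z
  cancel : ∀ a b → (a ℚ.+ b) ℚ.+ ℚ.- b ≡ a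
  cancel = solve 2 (λ a b → (a :+ b) :- b := a) refl
  bound : ι D ℚ.* (ι N ℚ.* Eλ n Z) ℚ.+ ιℤ y ℚ.≤ ι D ℚ.* (ι N ℚ.* X) ℚ.+ ιℤ y
  bound = subst₂ ℚ._≤_
    (trans (ιℤ-+ (+ D * + pairSum n Z) y) (cong (ℚ._+ ιℤ y) (trans (ιℤ-* (+ D) (+ pairSum n Z))
      (cong (ι D ℚ.*_) (sym (ι-suc*/ (pairSum n Z) (length zs)))))))
    (sym eq)
    (ιℤ-mono h)

energy≤diameter : ∀ n (Z : List (Point n)) → Unique Z → 1 ℕ.≤ length Z →
  Eλ n Z ℚ.≤ ι (length Z ∸ 1) ℚ.* ι (lam n n)
energy≤diameter n Z@(_ ∷ zs) u 1≤N = Eλ≤ n Z 1≤N 1 _ (+ lam n n * + length Z) (+ lam n n * (+ length Z * + length Z))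
  (subst (_≤ + lam n n * (+ length Z * + length Z))
    (cong (_+ + lam n n * + length Z) (sym (ℤ.*-identityˡ (+ pairSum n Z)))) (diameter-bound n Z u))
  (begin
    ι 1 ℚ.* (ι N ℚ.* (k ℚ.* ℓ)) ℚ.+ ιℤ (+ lam n n * + N)    ≡⟨ cong₂ (λ a b → ι 1 ℚ.* (a ℚ.* (k ℚ.* ℓ)) ℚ.+ b) N≡ (trans (ιℤ-* (+ lam n n) (+ N)) (cong (ℓ ℚ.*_) N≡)) ⟩
    ι 1 ℚ.* ((1ℚ ℚ.+ k) ℚ.* (k ℚ.* ℓ)) ℚ.+ ℓ ℚ.* (1ℚ ℚ.+ k)
      ≡⟨ solve 2 (λ k l → con 1ℚ :* ((con 1ℚ :+ k) :* (k :* l)) :+ l :* (con 1ℚ :+ k) := l :* ((con 1ℚ :+ k) :* (con 1ℚ :+ k))) refl k ℓ ⟩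
    ℓ ℚ.* ((1ℚ ℚ.+ k) ℚ.* (1ℚ ℚ.+ k))                       ≡⟨ cong (λ a → ℓ ℚ.* (a ℚ.* a)) N≡ ⟨
    ℓ ℚ.* (ι N ℚ.* ι N)                                     ≡⟨ cong (ℓ ℚ.*_) (ιℤ-* (+ N) (+ N)) ⟨
    ℓ ℚ.* ιℤ (+ N * + N)                                    ≡⟨ ιℤ-* (+ lam n n) (+ N * + N) ⟨
    ιℤ (+ lam n n * (+ N * + N))                            ∎)
  where
  open ≡-Reasoning
  N = length Z
  ℓ = ι (lam n n)
  k = ι (length zs)
  N≡ : ι N ≡ 1ℚ ℚ.+ k
  N≡ = ιℤ-+ 1ℤ (+ length zs)

-- `M` and `n` are variables with equations so that the parity split of `t - 1` can be handed over
-- and matched here.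
energy≤even : ∀ J {M n} → M ≡ suc (2 ℕ.* J) → n ≡ suc (2 ℕ.* M) →
  (Z : List (Point n)) → Unique Z → 1 ℕ.≤ length Z →
  Eλ n Z ℚ.≤ ι (lam n (suc M)) ℚ.* (ι (length Z) ℚ.- ½)
energy≤even J {M} {n} refl refl Z u 1≤N = Eλ≤ n Z 1≤N 2 _ (+ lam n (suc M) * + N) (+ 2 * + lam n (suc M) * (+ N * + N))
  (even-bound J Z u)
  (begin
    ι 2 ℚ.* (ι N ℚ.* (ℓ ℚ.* (ι N ℚ.- ½))) ℚ.+ ιℤ (+ lam n (suc M) * + N)
      ≡⟨ cong (ℚ._+_ (ι 2 ℚ.* (ι N ℚ.* (ℓ ℚ.* (ι N ℚ.- ½))))) (ιℤ-* (+ lam n (suc M)) (+ N)) ⟩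
    ι 2 ℚ.* (ι N ℚ.* (ℓ ℚ.* (ι N ℚ.- ½))) ℚ.+ ℓ ℚ.* ι N
      ≡⟨ solve 2 (λ N l → con (ι 2) :* (N :* (l :* (N :- con ½))) :+ l :* N := con (ι 2) :* l :* (N :* N)) refl (ι N) ℓ ⟩
    ι 2 ℚ.* ℓ ℚ.* (ι N ℚ.* ι N)
      ≡⟨ cong₂ ℚ._*_ (ιℤ-* (+ 2) (+ lam n (suc M))) (ιℤ-* (+ N) (+ N)) ⟨
    ιℤ (+ 2 * + lam n (suc M)) ℚ.* ιℤ (+ N * + N)
      ≡⟨ ιℤ-* (+ 2 * + lam n (suc M)) (+ N * + N) ⟨
    ιℤ (+ 2 * + lam n (suc M) * (+ N * + N)) ∎)
  where
  open ≡-Reasoning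
  N = length Z
  ℓ = ι (lam n (suc M))

energy≤odd : ∀ J {M n} → M ≡ 2 ℕ.* J → n ≡ suc (2 ℕ.* M) →
  (Z : List (Point n)) → Unique Z → 1 ℕ.≤ length Z →
  Eλ n Z ℚ.≤ (ι (lam n (suc M)) ℚ.* ι (length Z ℕ.* n) ℚ.- ι (lam n (suc M)) ℚ.* (ι (n ∸ 1) ℚ.* ½)) ℚ.* recipSuc n
-- `D = n + 1` cancels `recipSuc n`, and half of `n - 1 = 2M` is `M`.
energy≤odd J {M} {n} refl refl Z u 1≤N = Eλ≤ n Z 1≤N (suc n) _ (+ L * + M * + N) (+ L * + n * (+ N * + N))
  (subst₂ (λ a b → a * + pairSum n Z + + L * + M * + N ≤ + L * b * (+ N * + N)) a≡ b≡ (odd-bound J Z u))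
  (begin
    ι (suc n) ℚ.* (ι N ℚ.* ((ℓ ℚ.* ι (N ℕ.* n) ℚ.- ℓ ℚ.* (ι (2 ℕ.* M) ℚ.* ½)) ℚ.* recipSuc n)) ℚ.+ ιℤ (+ L * + M * + N)
      ≡⟨ cong₂ (λ a b → ι (suc n) ℚ.* (ι N ℚ.* ((ℓ ℚ.* a ℚ.- ℓ ℚ.* (b ℚ.* ½)) ℚ.* recipSuc n)) ℚ.+ ιℤ (+ L * + M * + N)) (ι-* N n) (ι-* 2 M) ⟩
    ι (suc n) ℚ.* (ι N ℚ.* ((ℓ ℚ.* (ι N ℚ.* ι n) ℚ.- ℓ ℚ.* (ι 2 ℚ.* ι M ℚ.* ½)) ℚ.* recipSuc n)) ℚ.+ ιℤ (+ L * + M * + N)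
      ≡⟨ cong₂ ℚ._+_
           (solve 6 (λ s N l n M r → s :* (N :* ((l :* (N :* n) :- l :* (con (ι 2) :* M :* con ½)) :* r))
              := (s :* r) :* (N :* (l :* (N :* n) :- l :* M))) refl (ι (suc n)) (ι N) ℓ (ι n) (ι M) (recipSuc n))
           (trans (ιℤ-* (+ L * + M) (+ N)) (cong (ℚ._* ι N) (ιℤ-* (+ L) (+ M)))) ⟩
    (ι (suc n) ℚ.* recipSuc n) ℚ.* (ι N ℚ.* (ℓ ℚ.* (ι N ℚ.* ι n) ℚ.- ℓ ℚ.* ι M)) ℚ.+ ℓ ℚ.* ι M ℚ.* ι N
      ≡⟨ cong (λ z → z ℚ.* (ι N ℚ.* (ℓ ℚ.* (ι N ℚ.* ι n) ℚ.- ℓ ℚ.* ι M)) ℚ.+ ℓ ℚ.* ι M ℚ.* ι N) (ι-suc*/ 1 n) ⟩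
    1ℚ ℚ.* (ι N ℚ.* (ℓ ℚ.* (ι N ℚ.* ι n) ℚ.- ℓ ℚ.* ι M)) ℚ.+ ℓ ℚ.* ι M ℚ.* ι N
      ≡⟨ solve 4 (λ N l n M → con 1ℚ :* (N :* (l :* (N :* n) :- l :* M)) :+ l :* M :* N := l :* n :* (N :* N)) refl (ι N) ℓ (ι n) (ι M) ⟩
    ℓ ℚ.* ι n ℚ.* (ι N ℚ.* ι N)
      ≡⟨ cong₂ ℚ._*_ (ιℤ-* (+ L) (+ n)) (ιℤ-* (+ N) (+ N)) ⟨
    ιℤ (+ L * + n) ℚ.* ιℤ (+ N * + N)
      ≡⟨ ιℤ-* (+ L * + n) (+ N * + N) ⟨
    ιℤ (+ L * + n * (+ N * + N)) ∎)
  where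
  open ≡-Reasoning
  N = length Z
  L = lam n (suc M)
  ℓ = ι L
  a≡ : + 2 * + suc M ≡ + suc n
  a≡ = trans (sym (ℤ.pos-* 2 (suc M))) (cong +_ (ℕ.*-suc 2 M))
  b≡ : + M + + suc M ≡ + n
  b≡ = cong +_ (trans (ℕ.+-suc M M) (cong (λ k → suc (M ℕ.+ k)) (sym (ℕ.+-identityʳ M))))

-- At index `m + 1` the Krawtchouk argument is `m`, the midpoint of `n - 1 = 2m`.
lamHat-middle : ∀ m → let n = suc (2 ℕ.* m) in lamHat n (suc m) ≡ ℚ.- (inv2^ n ℚ.* ι (central m))
lamHat-middle m = cong (λ z → ℚ.- (inv2^ (suc (2 ℕ.* m)) ℚ.* ιℤ z)) (kraw-square-sum m)

ι-∸ : ∀ {a b} → b ℕ.≤ a → ι (a ∸ b) ≡ ι a ℚ.- ι b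
ι-∸ {a} {b} b≤a = trans (solve 2 (λ x y → x := (x :+ y) :- y) refl (ι (a ∸ b)) (ι b))
  (cong (ℚ._- ι b) (trans (sym (ιℤ-+ (+ (a ∸ b)) (+ b))) (cong ι (ℕ.m∸n+n≡m b≤a))))

module _ (m : ℕ) (Z : List (Point (suc (2 ℕ.* m)))) (u : Unique Z) where
  open ≡-Reasoning
  private
    n = suc (2 ℕ.* m)
    N = length Z
    P = ι (2 ℕ.^ n)
    v = inv2^ n
    c₀ = central m
    B = n ℕ.* central n
    RHS = ι N ℚ.* Λ n ℚ.+ ι (2 ℕ.^ n ∸ N) ℚ.* lamHat n (suc m)

  spectral-value : RHS ≡ ι N ℚ.* Λ n ℚ.+ (P ℚ.- ι N) ℚ.* ℚ.- (v ℚ.* ι c₀)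
  -- `length≤2^n` ensures that the difference `2^n ∸ N` is not truncated.
  spectral-value = cong₂ (λ a b → ι N ℚ.* Λ n ℚ.+ a ℚ.* b) (ι-∸ (length≤2^n Z u)) (lamHat-middle m)

  spectral-closed-form : RHS ≡ ι N ℚ.* Λ n ℚ.- (1ℚ ℚ.- ι N ℚ.* v) ℚ.* ι c₀
  spectral-closed-form = begin
    RHS                                                          ≡⟨ spectral-value ⟩
    ι N ℚ.* Λ n ℚ.+ (P ℚ.- ι N) ℚ.* ℚ.- (v ℚ.* ι c₀)
      ≡⟨ solve 5 (λ N Λ P v c → N :* Λ :+ (P :- N) :* (:- (v :* c)) := N :* Λ :- (P :* v :- N :* v) :* c) refl (ι N) (Λ n) P v (ι c₀) ⟩
    ι N ℚ.* Λ n ℚ.- (P ℚ.* v ℚ.- ι N ℚ.* v) ℚ.* ι c₀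
      ≡⟨ cong (λ z → ι N ℚ.* Λ n ℚ.- (z ℚ.- ι N ℚ.* v) ℚ.* ι c₀) (inv2^-inverse n) ⟩
    ι N ℚ.* Λ n ℚ.- (1ℚ ℚ.- ι N ℚ.* v) ℚ.* ι c₀                 ∎

  energy≤spectral : 1 ℕ.≤ N → Eλ n Z ℚ.≤ RHS
  -- `D = 2^(n+1)` is the denominator in `Λ n`, and it also clears `inv2^ n`.
  energy≤spectral 1≤N = Eλ≤ n Z 1≤N (2 ℕ.* 2 ℕ.^ n) ⦃ ℕ.m*n≢0 2 (2 ℕ.^ n) ⦃ _ ⦄ ⦃ ℕ.m^n≢0 2 n ⦄ ⦄ RHS
    (+ (2 ℕ.* 2 ℕ.^ n ℕ.* c₀) * + N) (+ (B ℕ.+ 2 ℕ.* c₀) * (+ N * + N)) bound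
    (begin
      ι (2 ℕ.* 2 ℕ.^ n) ℚ.* (ι N ℚ.* RHS) ℚ.+ ιℤ (+ (2 ℕ.* 2 ℕ.^ n ℕ.* c₀) * + N)
        ≡⟨ cong₂ (λ a b → a ℚ.* (ι N ℚ.* RHS) ℚ.+ b) (ι-* 2 (2 ℕ.^ n))
             (trans (ιℤ-* (+ (2 ℕ.* 2 ℕ.^ n ℕ.* c₀)) (+ N)) (cong (ℚ._* ι N)
               (trans (ι-* (2 ℕ.* 2 ℕ.^ n) c₀) (cong (ℚ._* ι c₀) (ι-* 2 (2 ℕ.^ n)))))) ⟩
      ι 2 ℚ.* P ℚ.* (ι N ℚ.* RHS) ℚ.+ ι 2 ℚ.* P ℚ.* ι c₀ ℚ.* ι N
        ≡⟨ cong (λ z → ι 2 ℚ.* P ℚ.* (ι N ℚ.* z) ℚ.+ ι 2 ℚ.* P ℚ.* ι c₀ ℚ.* ι N) spectral-closed-form ⟩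
      ι 2 ℚ.* P ℚ.* (ι N ℚ.* (ι N ℚ.* (ι B ℚ.* (½ ℚ.* v)) ℚ.- (1ℚ ℚ.- ι N ℚ.* v) ℚ.* ι c₀)) ℚ.+ ι 2 ℚ.* P ℚ.* ι c₀ ℚ.* ι N
        ≡⟨ solve 5 (λ P N B v c →
             con (ι 2) :* P :* (N :* (N :* (B :* (con ½ :* v)) :- (con 1ℚ :- N :* v) :* c)) :+ con (ι 2) :* P :* c :* N
             := (P :* v) :* ((B :+ con (ι 2) :* c) :* (N :* N))) refl P (ι N) (ι B) v (ι c₀) ⟩
      (P ℚ.* v) ℚ.* ((ι B ℚ.+ ι 2 ℚ.* ι c₀) ℚ.* (ι N ℚ.* ι N))
        ≡⟨ trans (cong (ℚ._* ((ι B ℚ.+ ι 2 ℚ.* ι c₀) ℚ.* (ι N ℚ.* ι N))) (inv2^-inverse n)) (ℚ.*-identityˡ _) ⟩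
      (ι B ℚ.+ ι 2 ℚ.* ι c₀) ℚ.* (ι N ℚ.* ι N)
        ≡⟨ cong₂ ℚ._*_ (trans (ιℤ-+ (+ B) (+ (2 ℕ.* c₀))) (cong (ι B ℚ.+_) (ι-* 2 c₀))) (ιℤ-* (+ N) (+ N)) ⟨
      ι (B ℕ.+ 2 ℕ.* c₀) ℚ.* ιℤ (+ N * + N)
        ≡⟨ ιℤ-* (+ (B ℕ.+ 2 ℕ.* c₀)) (+ N * + N) ⟨
      ιℤ (+ (B ℕ.+ 2 ℕ.* c₀) * (+ N * + N)) ∎)
    where
    Q PS : ℤ
    Q = + (2 ℕ.^ n)
    PS = + pairSum n Z
    τ = T (+ 2) n 0 e 0
    ring₁ : ∀ Q s c N → + 2 * (Q * (s + c * N)) ≡ + 2 * Q * s + + 2 * Q * c * N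
    ring₁ = solve-∀
    ring₂ : ∀ t c N → + 2 * ((t + c) * (N * N)) ≡ (+ 2 * t + + 2 * c) * (N * N)
    ring₂ = solve-∀
    D≡ : + 2 * Q ≡ + (2 ℕ.* 2 ℕ.^ n)
    D≡ = sym (ℤ.pos-* 2 (2 ℕ.^ n))
    bound : + (2 ℕ.* 2 ℕ.^ n) * PS + + (2 ℕ.* 2 ℕ.^ n ℕ.* c₀) * + N ≤ + (B ℕ.+ 2 ℕ.* c₀) * (+ N * + N)
    bound = subst₂ _≤_
      (trans (ring₁ Q PS (+ c₀) (+ N)) (cong₂ (λ a b → a * PS + b * + N) D≡
        (trans (cong (_* + c₀) D≡) (sym (ℤ.pos-* (2 ℕ.* 2 ℕ.^ n) c₀)))))
      (trans (ring₂ τ (+ c₀) (+ N)) (cong (_* (+ N * + N))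
        (cong₂ _+_ (trans (T-e-plus n) (sym (ℤ.pos-* n (central n)))) (sym (ℤ.pos-* 2 c₀)))))
      (ℤ.*-monoˡ-≤-nonNeg (+ 2) (spectral-bound m Z u))

-- Parity of t and assembly of the bounds

even%2 : ∀ i → (2 ℕ.* i) % 2 ≡ 0
even%2 i = trans (cong (_% 2) (ℕ.*-comm 2 i)) (ℕ.m*n%n≡0 i 2)

odd%2 : ∀ i → suc (2 ℕ.* i) % 2 ≡ 1
odd%2 i = trans (cong (λ k → suc k % 2) (ℕ.*-comm 2 i)) (ℕ.[m+kn]%n≡m%n 1 i 2)


theorem5p2 : (n N : ℕ) → 1 ℕ.≤ N → (Z : List (Point n)) → Unique Z → length Z ≡ N →
    (Eλ n Z ℚ.≤ ι (N ∸ 1) ℚ.* ι (lam n n))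
    × ((t : ℕ) → 1 ℕ.≤ t → n ≡ 2 ℕ.* t ∸ 1 →
    (t % 2 ≡ 0 → Eλ n Z ℚ.≤ ι (lam n t) ℚ.* (ι N ℚ.- ½))
    × (t % 2 ≡ 1 → Eλ n Z ℚ.≤ (ι (lam n t) ℚ.* ι (N ℕ.* n)
    ℚ.- ι (lam n t) ℚ.* (ι (n ∸ 1) ℚ.* ½))
    ℚ.* recipSuc n))
    × ((m : ℕ) → n ≡ 2 ℕ.* m ℕ.+ 1 →
    (Eλ n Z ℚ.≤ ι N ℚ.* lamHat n 0 ℚ.+ ι (2 ^ n ∸ N) ℚ.* lamHat n (ℕ.suc m))
    × (ι N ℚ.* lamHat n 0 ℚ.+ ι (2 ^ n ∸ N) ℚ.* lamHat n (ℕ.suc m)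
    ≡ ι N ℚ.* Λ n ℚ.- (ℚ.1ℚ ℚ.- ι N ℚ.* inv2^ n) ℚ.* ι ((n ∸ 1) C m)))
theorem5p2 n N 1≤N Z u refl = energy≤diameter n Z u 1≤N , part₂ , part₃
  where
  n≡ : ∀ {M} → n ≡ 2 ℕ.* suc M ∸ 1 → n ≡ suc (2 ℕ.* M)
  n≡ {M} h = trans h (cong (_∸ 1) (ℕ.*-suc 2 M))
  part₂ : (t : ℕ) → 1 ℕ.≤ t → n ≡ 2 ℕ.* t ∸ 1 → _ × _
  part₂ (suc M) _ h with parity M
  -- As `t = M + 1`, an even `M` means an odd `t`.
  ... | J , inj₁ M≡ =
    (λ t%2≡0 → contradiction (trans (sym t%2≡0) (trans (cong (λ k → suc k % 2) M≡) (odd%2 J))) λ ()) ,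
    (λ _ → energy≤odd J M≡ (n≡ h) Z u 1≤N)
  ... | J , inj₂ M≡ =
    (λ _ → energy≤even J M≡ (n≡ h) Z u 1≤N) ,
    (λ t%2≡1 → contradiction (trans (sym t%2≡1) (trans (cong (λ k → suc k % 2) M≡)
      (trans (cong (_% 2) (sym (ℕ.*-suc 2 J))) (even%2 (suc J))))) λ ())
  part₃ : (m : ℕ) → n ≡ 2 ℕ.* m ℕ.+ 1 → _ × _
  part₃ m h with trans h (ℕ.+-comm (2 ℕ.* m) 1)
  ... | refl = energy≤spectral m Z u 1≤N , spectral-closed-form m Z u
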